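{- Let $p$ be an odd prime. If $A,B\subseteq\mathbb{F}_p$ satisfy $A+B=P_p$ and $|A|=|B|$, then $$\sqrt{\varphi(p-1)}\le |A|<\sqrt{p}.$$
   Context: $\mathbb{F}_p$ is the finite field with $p$ elements. $P_p$ denotes the set of primitive elements of $\mathbb{F}_p$, i.e. the generators of the cyclic group $\mathbb{F}_p^{\times}$. For $A,B\subseteq\mathbb{F}_p$, $A+B=\{a+b: a\in A,\ b\in B\}$. $\varphi$ is Euler's totient function. -}

module Defs where

open import Algebra.Bundles.Raw using (RawSemiring)
import Algebra.Definitions.RawSemiring as RawSemiringOps
open import Data.Empty using (⊥)
open import Data.Fin using (Fin; toℕ)
open import Data.Fin.Subset using (Subset; _∈_)
open import Data.Integer using (+_)
open import Data.List using (length; filter; applyUpTo)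
open import Data.Nat as ℕ using (ℕ; suc; NonZero)
open import Data.Nat.Coprimality using (coprime?)
open import Data.Nat.DivMod using (_mod_)
open import Data.Product using (∃; _×_; _,_)
open import Data.Rational
  using (ℚ; _<_; _≤_; _+_; _*_; _-_; _/_; 1/_; 0ℚ; 1ℚ; positive; nonNegative)
import Data.Rational as ℚ
open import Data.Rational.Properties
open import Data.Rational.Solver using (module +-*-Solver)
open import Data.Sum using (_⊎_; inj₁; inj₂)
open import Level using (0ℓ)
open import Relation.Binary.Definitions using (tri<; tri≈; tri>)
open import Relation.Binary.PropositionalEquality
open import Relation.Nullary using (yes; no)
open import Relation.Unary using (Pred)

------------------------------------------------------------------------
-- Real numbers as two-sided Dedekind cuts

-- L q means q < x, and U q means x < q.

record ℝ : Set₁ where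
  field
    L U       : ℚ → Set
    L-inhab   : ∃ L
    U-inhab   : ∃ U
    L-closed  : ∀ {q r} → q < r → L r → L q
    U-closed  : ∀ {q r} → q < r → U q → U r
    L-rounded : ∀ {q} → L q → ∃ λ r → q < r × L r
    U-rounded : ∀ {r} → U r → ∃ λ q → q < r × U q
    disjoint  : ∀ {q} → L q → U q → ⊥
    located   : ∀ {q r} → q < r → L q ⊎ U r

infix 4 _≤ᴿ_ _<ᴿ_

_≤ᴿ_ : ℝ → ℝ → Set
x ≤ᴿ y = ∀ q → ℝ.L x q → ℝ.L y q

_<ᴿ_ : ℝ → ℝ → Set
x <ᴿ y = ∃ λ q → ℝ.U x q × ℝ.L y q

private
  x<x+1 : ∀ x → x < x + 1ℚ
  x<x+1 x = subst (_< x + 1ℚ) (+-identityʳ x) (+-monoʳ-< x (positive⁻¹ 1ℚ))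

  x-1<x : ∀ x → x - 1ℚ < x
  x-1<x x = subst (x - 1ℚ <_) (+-identityʳ x) (+-monoʳ-< x (negative⁻¹ (ℚ.- 1ℚ)))

fromℚ : ℚ → ℝ
fromℚ x = record
  { L         = _< x
  ; U         = x <_
  ; L-inhab   = x - 1ℚ , x-1<x x
  ; U-inhab   = x + 1ℚ , x<x+1 x
  ; L-closed  = <-trans
  ; U-closed  = λ q<r x<q → <-trans x<q q<r
  ; L-rounded = λ q<x → let m , q<m , m<x = <-dense q<x in m , q<m , m<x
  ; U-rounded = λ x<r → let m , x<m , m<r = <-dense x<r in m , m<r , x<m
  ; disjoint  = λ q<x x<q → <-asym q<x x<q
  ; located   = loc
  }
  where
  loc : ∀ {q r} → q < r → q < x ⊎ x < r
  loc {q} q<r with q <? x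
  ... | yes q<x = inj₁ q<x
  ... | no  q≮x = inj₂ (≤-<-trans (≮⇒≥ q≮x) q<r)

fromℕ : ℕ → ℝ
fromℕ n = fromℚ (+ n / 1)

private
  *-mono-<-nonNeg : ∀ {q r} → 0ℚ ≤ q → q < r → q * q < r * r
  *-mono-<-nonNeg {q} {r} 0≤q q<r = ≤-<-trans
    (*-monoˡ-≤-nonNeg q {{nonNegative 0≤q}} (<⇒≤ q<r))
    (*-monoˡ-<-pos r {{positive (≤-<-trans 0≤q q<r)}} q<r)

  1≤n⇒n≤n² : ∀ {n} → 1ℚ ≤ n → n ≤ n * n
  1≤n⇒n≤n² {n} 1≤n = subst (_≤ n * n) (*-identityʳ n)
    (*-monoˡ-≤-nonNeg n {{nonNegative (≤-trans (nonNegative⁻¹ 1ℚ) 1≤n)}} 1≤n)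

  0≤q² : ∀ {q} → 0ℚ ≤ q → 0ℚ ≤ q * q
  0≤q² {q} 0≤q = nonNegative⁻¹ (q * q)
    {{nonNeg*nonNeg⇒nonNeg q {{nonNegative 0≤q}} q {{nonNegative 0≤q}}}}

  p≤q⇒0≤q-p : ∀ {p q} → p ≤ q → 0ℚ ≤ q - p
  p≤q⇒0≤q-p {p} {q} p≤q = subst (_≤ q - p) (+-inverseʳ p) (+-monoˡ-≤ (ℚ.- p) p≤q)

  0≤q-p⇒p≤q : ∀ {p q} → 0ℚ ≤ q - p → p ≤ q
  0≤q-p⇒p≤q {p} {q} 0≤q-p = subst₂ _≤_ (+-identityˡ p)
    (solve 2 (λ p q → q :- p :+ p := q) refl p q) (+-monoˡ-≤ p 0≤q-p)
    where open +-*-Solver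

  -- For q, s ≥ 0 and c = s + 1, the number r = (c q + s) / (q + c) satisfies
  --   (q + c) (r - q) = s - q²   and   (q + c)² (r² - s) = (c² - s) (q² - s),
  -- so r lies strictly between q and √s whenever q² ≠ s.
  module Between (q s : ℚ) (0≤q : 0ℚ ≤ q) (0≤s : 0ℚ ≤ s) where
    open +-*-Solver

    c d : ℚ
    c = s + 1ℚ
    d = q + c

    1≤c : 1ℚ ≤ c
    1≤c = subst (_≤ c) (+-identityˡ 1ℚ) (+-monoˡ-≤ 1ℚ 0≤s)

    0<c : 0ℚ < c
    0<c = <-≤-trans (positive⁻¹ 1ℚ) 1≤c

    0<d : 0ℚ < d
    0<d = +-mono-≤-< 0≤q 0<c

    instance
      d-pos : ℚ.Positive d
      d-pos = positive 0<d

      d-nonNeg : ℚ.NonNegative d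
      d-nonNeg = pos⇒nonNeg d

      d-nonZero : ℚ.NonZero d
      d-nonZero = pos⇒nonZero d

    r : ℚ
    r = (c * q + s) * 1/ d

    r*d : r * d ≡ c * q + s
    r*d = trans (*-assoc (c * q + s) (1/ d) d)
         (trans (cong ((c * q + s) *_) (*-inverseˡ d)) (*-identityʳ _))

    q*d : q * d ≡ c * q + q * q
    q*d = solve 2 (λ q c → q :* (q :+ c) := c :* q :+ q :* q) refl q c

    0≤c²-s : 0ℚ ≤ c * c - s
    0≤c²-s = p≤q⇒0≤q-p (≤-trans (<⇒≤ (x<x+1 s)) (1≤n⇒n≤n² 1≤c))

    r²*d² : r * r * d * d ≡ (c * q + s) * (c * q + s)
    r²*d² = trans (solve 2 (λ r d → r :* r :* d :* d := (r :* d) :* (r :* d)) refl r d)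
                  (cong₂ _*_ r*d r*d)

    factor : r * r * d * d - s * d * d ≡ (c * c - s) * (q * q - s)
    factor = trans (cong (_- s * d * d) r²*d²)
      (solve 3 (λ q s c →
          (c :* q :+ s) :* (c :* q :+ s) :- s :* (q :+ c) :* (q :+ c)
          := (c :* c :- s) :* (q :* q :- s)) refl q s c)

    factor′ : s * d * d - r * r * d * d ≡ (c * c - s) * (s - q * q)
    factor′ = trans (solve 2 (λ x y → x :- y := :- (y :- x)) refl (s * d * d) (r * r * d * d))
      (trans (cong ℚ.-_ factor)
        (solve 3 (λ x y z → :- (x :* (y :- z)) := x :* (z :- y)) refl (c * c - s) (q * q) s))

    prod-nonNeg : ∀ {x} → 0ℚ ≤ x → 0ℚ ≤ (c * c - s) * x
    prod-nonNeg {x} 0≤x = nonNegative⁻¹ _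
      {{nonNeg*nonNeg⇒nonNeg (c * c - s) {{nonNegative 0≤c²-s}} x {{nonNegative 0≤x}}}}

    up : q * q < s → q < r × r * r ≤ s
    up q²<s = *-cancelʳ-<-nonNeg d (subst₂ _<_ (sym q*d) (sym r*d) (+-monoʳ-< (c * q) q²<s))
            , *-cancelʳ-≤-pos d (*-cancelʳ-≤-pos d
                (0≤q-p⇒p≤q (subst (0ℚ ≤_) (sym factor′) (prod-nonNeg (p≤q⇒0≤q-p (<⇒≤ q²<s))))))

    down : 0ℚ < q → s < q * q → 0ℚ < r × r < q × s ≤ r * r
    down 0<q s<q² = *-cancelʳ-<-nonNeg d (subst₂ _<_ (sym (*-zeroˡ d)) (sym r*d) 0<cq+s)
            , *-cancelʳ-<-nonNeg d (subst₂ _<_ (sym r*d) (sym q*d) (+-monoʳ-< (c * q) s<q²))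
            , *-cancelʳ-≤-pos d (*-cancelʳ-≤-pos d
                (0≤q-p⇒p≤q (subst (0ℚ ≤_) (sym factor) (prod-nonNeg (p≤q⇒0≤q-p (<⇒≤ s<q²))))))
      where
      0<cq+s : 0ℚ < c * q + s
      0<cq+s = +-mono-<-≤
        (positive⁻¹ (c * q) {{pos*pos⇒pos c {{positive 0<c}} q {{positive 0<q}}}}) 0≤s

-- The square root of a nonnegative real; √ x = 0 when x < 0.

√_ : ℝ → ℝ
√ x = record
  { L         = L√
  ; U         = U√
  ; L-inhab   = ℚ.- 1ℚ , inj₁ (negative⁻¹ (ℚ.- 1ℚ))
  ; U-inhab   = inhabᵁ
  ; L-closed  = closedᴸ
  ; U-closed  = λ { q<r (0<q , q²∈U) →
      <-trans 0<q q<r , X.U-closed (*-mono-<-nonNeg (<⇒≤ 0<q) q<r) q²∈U }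
  ; L-rounded = roundedᴸ
  ; U-rounded = roundedᵁ
  ; disjoint  = λ { (inj₁ q<0)  (0<q , _)    → <-asym q<0 0<q
                  ; (inj₂ q²∈L) (_   , q²∈U) → X.disjoint q²∈L q²∈U }
  ; located   = located√
  }
  where
  module X = ℝ x

  L√ U√ : ℚ → Set
  L√ q = q < 0ℚ ⊎ X.L (q * q)
  U√ q = 0ℚ < q × X.U (q * q)

  ≤-closedᴸ : ∀ {q r} → q ≤ r → X.L r → X.L q
  ≤-closedᴸ {q} {r} q≤r r∈L with <-cmp q r
  ... | tri< q<r _ _ = X.L-closed q<r r∈L
  ... | tri≈ _ q≡r _ = subst X.L (sym q≡r) r∈L
  ... | tri> _ _ r<q with () ← <-irrefl refl (≤-<-trans q≤r r<q)

  ≤-closedᵁ : ∀ {q r} → q ≤ r → X.U q → X.U r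
  ≤-closedᵁ {q} {r} q≤r q∈U with <-cmp q r
  ... | tri< q<r _ _ = X.U-closed q<r q∈U
  ... | tri≈ _ q≡r _ = subst X.U q≡r q∈U
  ... | tri> _ _ r<q with () ← <-irrefl refl (≤-<-trans q≤r r<q)

  inhabᵁ : ∃ U√
  inhabᵁ with X.U-inhab
  ... | u , u∈U with 1ℚ ≤? u
  ...   | yes 1≤u = u , <-≤-trans (positive⁻¹ 1ℚ) 1≤u , ≤-closedᵁ (1≤n⇒n≤n² 1≤u) u∈U
  ...   | no  1≰u = 1ℚ , positive⁻¹ 1ℚ , X.U-closed (≰⇒> 1≰u) u∈U

  closedᴸ : ∀ {q r} → q < r → L√ r → L√ q
  closedᴸ     q<r (inj₁ r<0)  = inj₁ (<-trans q<r r<0)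
  closedᴸ {q} q<r (inj₂ r²∈L) with q <? 0ℚ
  ... | yes q<0 = inj₁ q<0
  ... | no  q≮0 = inj₂ (X.L-closed (*-mono-<-nonNeg (≮⇒≥ q≮0) q<r) r²∈L)

  roundedᴸ : ∀ {q} → L√ q → ∃ λ r → q < r × L√ r
  roundedᴸ {q} q∈L√ with q <? 0ℚ | q∈L√
  ... | yes q<0 | _ = let m , q<m , m<0 = <-dense q<0 in m , q<m , inj₁ m<0
  ... | no  q≮0 | inj₁ q<0 with () ← q≮0 q<0
  ... | no  q≮0 | inj₂ q²∈L =
    let s , q²<s , s∈L = X.L-rounded q²∈L
        0≤q            = ≮⇒≥ q≮0
        open Between q s 0≤q (≤-trans (0≤q² 0≤q) (<⇒≤ q²<s))
        q<r , r²≤s     = up q²<s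
    in r , q<r , inj₂ (≤-closedᴸ r²≤s s∈L)

  roundedᵁ : ∀ {q} → U√ q → ∃ λ r → r < q × U√ r
  roundedᵁ {q} (0<q , q²∈U) with X.U-rounded q²∈U
  ... | s , s<q² , s∈U with 0ℚ ≤? s
  ...   | yes 0≤s =
    let open Between q s (<⇒≤ 0<q) 0≤s
        0<r , r<q , s≤r² = down 0<q s<q²
    in r , r<q , 0<r , ≤-closedᵁ s≤r² s∈U
  ...   | no  0≰s =
    let r , 0<r , r<q = <-dense 0<q
    in r , r<q , 0<r , X.U-closed (<-≤-trans (≰⇒> 0≰s) (0≤q² (<⇒≤ 0<r))) s∈U

  located√ : ∀ {q r} → q < r → L√ q ⊎ U√ r
  located√ {q} q<r with q <? 0ℚ
  ... | yes q<0 = inj₁ (inj₁ q<0)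
  ... | no  q≮0 with X.located (*-mono-<-nonNeg (≮⇒≥ q≮0) q<r)
  ...   | inj₁ q²∈L = inj₁ (inj₂ q²∈L)
  ...   | inj₂ r²∈U = inj₂ (≤-<-trans (≮⇒≥ q≮0) q<r , r²∈U)

------------------------------------------------------------------------
-- Euler's totient function

φ : ℕ → ℕ
φ n = length (filter (λ k → coprime? k n) (applyUpTo suc n))

------------------------------------------------------------------------
-- The field 𝔽 p, as the residues 0, …, p - 1 with arithmetic modulo p

𝔽 : (p : ℕ) .{{_ : NonZero p}} → RawSemiring 0ℓ 0ℓ
𝔽 p = record
  { Carrier = Fin p
  ; _≈_     = _≡_
  ; _+_     = λ a b → (toℕ a ℕ.+ toℕ b) mod p
  ; _*_     = λ a b → (toℕ a ℕ.* toℕ b) mod p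
  ; 0#      = 0 mod p
  ; 1#      = 1 mod p
  }

module _ {p : ℕ} .{{_ : NonZero p}} where

  open RawSemiring (𝔽 p) using (0#) renaming (_+_ to _+ᶠ_)
  open RawSemiringOps (𝔽 p) using (_^_)

  infixl 6 _+ˢ_

  _+ˢ_ : Subset p → Subset p → Pred (Fin p) 0ℓ
  (A +ˢ B) x = ∃ λ a → ∃ λ b → a ∈ A × b ∈ B × x ≡ a +ᶠ b

  -- Natural exponents suffice to express that g generates the group of
  -- nonzero elements, since that group is finite.
  IsPrimitive : Pred (Fin p) 0ℓ
  IsPrimitive g = g ≢ 0# × (∀ x → x ≢ 0# → ∃ λ k → x ≡ g ^ k)

{-# OPTIONS --safe #-}
module Submission where

-- Lower bound.  𝔽ₚˣ contains an element g of order p - 1, and the φ(p - 1) powers gᵏ with k coprime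
-- to p - 1 are distinct primitive elements, each of which must be one of the |A||B| sums a + b.
-- Upper bound.  A primitive element is not a square, so the quadratic character χ satisfies
-- Σ_{a ∈ A} χ(a + b) = -|A| for every b ∈ B.  Since Σ_x χ(a + x) χ(a′ + x) = p [a = a′] - 1, the
-- squares of Σ_{a ∈ A} χ(a + x) sum over all x to p|A| - |A|².  Hence |B||A|² ≤ p|A| - |A|².

open import Defs
open import Algebra.Bundles using (CommutativeRing; CommutativeSemiring; RawSemiring)
open import Data.Bool using (true; false; if_then_else_)
open import Data.Fin as Fin using (Fin; zero; suc; toℕ; punchOut)
open import Data.Fin.Permutation using (Permutation′; permutation)
open import Data.Fin.Properties as Fin
  using (any?; injective⇒≤; punchOut-injective; toℕ-fromℕ<; toℕ-injective; toℕ<n; ¬∀⟶∃¬)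
open import Data.Fin.Subset using (Subset; ∣_∣; _∈_; inside; outside)
open import Data.Integer as ℤ using (ℤ; +_; -[1+_]; 0ℤ; 1ℤ; -1ℤ; +≤+; +<+)
import Data.Integer.Properties as ℤ
import Data.Integer.Tactic.RingSolver as ℤ-Solver
open import Data.List as List
  using (List; []; _∷_; length; allFin; applyUpTo; cartesianProductWith; filter)
open import Data.List.Membership.DecPropositional using () renaming (_∈?_ to ∈ᴸ-dec)
open import Data.List.Membership.Propositional using () renaming (_∈_ to _∈ᴸ_)
open import Data.List.Membership.Propositional.Properties
  using (∈-allFin; ∈-applyUpTo⁻; ∈-cartesianProductWith⁺; ∈-filter⁻; ∈-lookup; ∈-map⁺; ∈-map⁻)
import Data.List.Membership.Setoid.Properties as Membershipₛ
open import Data.List.Properties using (length-++; length-applyUpTo; length-map; length-tabulate)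
open import Data.List.Relation.Binary.Subset.Propositional using (_⊆_)
open import Data.List.Relation.Unary.All as All using (All; []; _∷_)
import Data.List.Relation.Unary.All.Properties as All
open import Data.List.Relation.Unary.AllPairs using (AllPairs; []; _∷_)
import Data.List.Relation.Unary.AllPairs.Properties as AllPairs
open import Data.List.Relation.Unary.Any as Any using (index)
open import Data.List.Relation.Unary.Unique.Propositional using (Unique)
import Data.List.Relation.Unary.Unique.Propositional.Properties as Unique
open import Data.Nat as ℕ using (ℕ; zero; suc; _∸_; NonZero; s≤s; z≤n; z<s)
open import Data.Nat.Coprimality as Coprimality
  using (Coprime; 1-coprimeTo; coprime?; coprime-Bézout; coprime-divisor)
open import Data.Nat.DivMod
  using (_%_; _mod_; %-distribˡ-+; %-distribˡ-*; m<n⇒m%n≡m; m%n<n; n%n≡0)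
open import Data.Nat.Divisibility hiding (quotient)
open import Data.Nat.GCD using (module Bézout)
open import Data.Nat.Induction using (<-rec)
open import Data.Nat.ListAction using (product)
open import Data.Nat.Primality
  using (Prime; euclidsLemma; prime⇒irreducible; prime⇒nonTrivial; prime⇒nonZero; ¬prime[1])
open import Data.Nat.Primality.Factorisation using (factorise)
import Data.Nat.Properties as ℕ
open import Data.Nat.Tactic.RingSolver using (solve-∀)
open import Data.Product using (∃; ∃₂; _×_; _,_; proj₁; proj₂)
open import Data.Rational as ℚ using (mkℚ; 0ℚ; _/_; *≤*; *<*)
import Data.Rational.Properties as ℚ
open import Data.Sum as Sum using (_⊎_; inj₁; inj₂)
open import Data.Vec as Vec using (Vec; []; _∷_; here; there; lookup)
open import Data.Vec.Properties using (lookup⇒[]=)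
open import Function using (_∘_; id)
open import Function.Definitions using (Injective)
open import Level using (0ℓ)
open import Relation.Binary.PropositionalEquality as ≡
  using (_≡_; _≢_; refl; sym; trans; cong; cong₂; subst; subst₂; isEquivalence)
open import Relation.Nullary using (¬_; Dec; yes; no; contradiction)
open import Relation.Unary using (_≐_) renaming (_⊆_ to _⊆ᵁ_)
open import Algebra.Properties.Semiring.Sum ℤ.+-*-semiring
  using (sum; sum-cong-≗; sum-permute; ∑-comm; ∑-distrib-+; *-distribˡ-sum; *-distribʳ-sum)

-- The two bounds rest on the two inclusions in A + B = P separately; |A| = |B| enters when |A||B|
-- and |B||A|² are turned into powers of |A|. Both bounds draw on one fact: X^m - 1 has at most m
-- roots, so for 0 < m < p - 1 some nonzero x has x^m ≠ 1. This supplies the elements of prime power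
-- order from which g is built. With m = (p - 1)/2 it also supplies the nonresidue that makes χ sum
-- to zero and forces χ = -1 on primitive elements. Accordingly χ is defined by Euler's criterion
-- instead of by squares, and its multiplicativity comes from the laws of exponents. The strict
-- inequality has its origin in the -1 of the correlation sum: for nonempty A it leads to |A|² + |A|
-- ≤ p.

module _ {a} {A : Set a} where

  lookup-injective : ∀ {xs : List A} → Unique xs → ∀ {i j} → List.lookup xs i ≡ List.lookup xs j → i ≡ j
  lookup-injective {_ ∷ _} (_ ∷ _) {zero} {zero} _ = refl
  lookup-injective {_ ∷ xs} (x∉ ∷ _) {zero} {suc j} eq = contradiction eq (All.lookup x∉ (∈-lookup j))
  lookup-injective {_ ∷ xs} (x∉ ∷ _) {suc i} {zero} eq = contradiction (sym eq) (All.lookup x∉ (∈-lookup i))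
  lookup-injective {_ ∷ _} (_ ∷ u) {suc i} {suc j} eq = cong suc (lookup-injective u eq)

  -- Pigeonhole: sending each position in `xs` to the position of its entry in `ys` is injective.
  Unique∧⊆⇒length≤ : ∀ {xs ys : List A} → Unique xs → xs ⊆ ys → length xs ℕ.≤ length ys
  Unique∧⊆⇒length≤ {xs} {ys} u xs⊆ys = injective⇒≤ {f = λ i → index (xs⊆ys (∈-lookup i))}
    λ {i} {j} eq → lookup-injective u
      (Membershipₛ.index-injective (≡.setoid A) (xs⊆ys (∈-lookup i)) (xs⊆ys (∈-lookup j)) eq)

-- Coprimality and divisibility

prime∧∤⇒coprime : ∀ {q n} → Prime q → q ∤ n → Coprime q n
prime∧∤⇒coprime q-prime q∤n (d∣q , d∣n) with prime⇒irreducible q-prime d∣q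
... | inj₁ d≡1    = d≡1
... | inj₂ refl   = contradiction d∣n q∤n

coprime-* : ∀ {a b n} → Coprime a n → Coprime b n → Coprime (a ℕ.* b) n
coprime-* {a} {b} a⊥n b⊥n {d} (d∣ab , d∣n) = b⊥n (coprime-divisor d⊥a d∣ab , d∣n)
  where
  d⊥a : Coprime d a
  d⊥a (e∣d , e∣a) = a⊥n (e∣a , ∣-trans e∣d d∣n)

coprime-^ : ∀ {a n} e → Coprime a n → Coprime (a ℕ.^ e) n
coprime-^ zero    a⊥n = 1-coprimeTo _
coprime-^ (suc e) a⊥n = coprime-* a⊥n (coprime-^ e a⊥n)

coprime∧∣∧∣⇒*∣ : ∀ {m n j} → Coprime m n → m ∣ j → n ∣ j → m ℕ.* n ∣ j
coprime∧∣∧∣⇒*∣ {m} {n} m⊥n (divides-refl k) n∣km =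
  subst (m ℕ.* n ∣_) (ℕ.*-comm m k) (*-monoʳ-∣ m
    (coprime-divisor (Coprimality.sym m⊥n) (subst (n ∣_) (ℕ.*-comm k m) n∣km)))

-- Roots of monic polynomials

module MonicPolynomials {c ℓ} (R : CommutativeSemiring c ℓ) where

  open CommutativeSemiring R renaming (refl to ≈-refl; sym to ≈-sym; trans to ≈-trans)
  open import Algebra.Solver.Ring.NaturalCoefficients.Default R using (solve; _:=_; _:+_; _:*_; con)
  open import Relation.Binary.Reasoning.Setoid setoid

  -- The monic polynomial X^d + c_{d-1} X^{d-1} + ⋯ + c₀, lowest coefficient first.
  ⟦_⟧ : ∀ {d} → Vec Carrier d → Carrier → Carrier
  ⟦ [] ⟧     x = 1#
  ⟦ c ∷ cs ⟧ x = c + x * ⟦ cs ⟧ x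

  -- Horner's scheme: dividing by X - a, the coefficients of the quotient are the values at `a` of
  -- the successive tails of the polynomial.
  quotient : ∀ {d} → Vec Carrier (suc d) → Carrier → Vec Carrier d
  quotient (c ∷ [])           a = []
  quotient (c ∷ cs@(_ ∷ _)) a = ⟦ cs ⟧ a ∷ quotient cs a

  -- f(x) - f(a) = (x - a) q(x), with the subtractions moved across.
  quotient-correct : ∀ {d} (f : Vec Carrier (suc d)) a x →
    ⟦ f ⟧ x + a * ⟦ quotient f a ⟧ x ≈ ⟦ f ⟧ a + x * ⟦ quotient f a ⟧ x
  quotient-correct (c ∷ []) a x =
    solve 3 (λ c a x → (c :+ x :* con 1) :+ a :* con 1 := (c :+ a :* con 1) :+ x :* con 1) ≈-refl c a x
  quotient-correct (c ∷ f@(_ ∷ _)) a x = begin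
    (c + x * fx) + a * (fa + x * qx)  ≈⟨ solve 6 (λ c a x fx fa qx →
        (c :+ x :* fx) :+ a :* (fa :+ x :* qx) := (c :+ a :* fa) :+ x :* (fx :+ a :* qx)) ≈-refl c a x fx fa qx ⟩
    (c + a * fa) + x * (fx + a * qx)  ≈⟨ +-congˡ (*-congˡ (quotient-correct f a x)) ⟩
    (c + a * fa) + x * (fa + x * qx)  ∎
    where
    fx = ⟦ f ⟧ x
    fa = ⟦ f ⟧ a
    qx = ⟦ quotient f a ⟧ x

  module _ (cancel : ∀ {x y z} → x * z ≈ y * z → x ≈ y ⊎ z ≈ 0#)
           (+-cancelˡ : ∀ x y z → x + y ≈ x + z → y ≈ z)
           (1≉0 : ¬ (1# ≈ 0#)) where

    -- Split off one root a. For another root x the division identity becomes a q(x) = x q(x), so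
    -- q(x) = 0 by `cancel`, which expresses the absence of zero divisors without subtraction.
    roots≤degree : ∀ {d} (f : Vec Carrier d) {xs} → AllPairs (λ x y → ¬ (x ≈ y)) xs →
                   All (λ x → ⟦ f ⟧ x ≈ 0#) xs → length xs ℕ.≤ d
    roots≤degree f        []                       _              = z≤n
    roots≤degree []       (_ ∷ _)                  (1≈0 ∷ _)      = contradiction 1≈0 1≉0
    roots≤degree f@(_ ∷ _) {a ∷ xs} (a≉xs ∷ distinct) (fa≈0 ∷ roots) =
      s≤s (roots≤degree (quotient f a) distinct
        (All.map (λ {(a≉x , fx≈0) → root a≉x fx≈0}) (All.zip (a≉xs , roots))))
      where
      root : ∀ {x} → ¬ (a ≈ x) → ⟦ f ⟧ x ≈ 0# → ⟦ quotient f a ⟧ x ≈ 0#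
      root {x} a≉x fx≈0 with cancel {a} {x} (+-cancelˡ 0# _ _ (begin
          0# + a * ⟦ quotient f a ⟧ x       ≈⟨ +-congʳ fx≈0 ⟨
          ⟦ f ⟧ x + a * ⟦ quotient f a ⟧ x  ≈⟨ quotient-correct f a x ⟩
          ⟦ f ⟧ a + x * ⟦ quotient f a ⟧ x  ≈⟨ +-congʳ fa≈0 ⟩
          0# + x * ⟦ quotient f a ⟧ x       ∎))
      ... | inj₁ a≈x = contradiction a≈x a≉x
      ... | inj₂ q≈0 = q≈0

-- Orders of elements

module Orders {c ℓ} (R : CommutativeSemiring c ℓ) where

  open CommutativeSemiring R renaming (refl to ≈-refl; sym to ≈-sym; trans to ≈-trans)
  open import Algebra.Properties.CommutativeSemiring.Exp R
  open import Relation.Binary.Reasoning.Setoid setoid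

  1^n≈1 : ∀ n → 1# ^ n ≈ 1#
  1^n≈1 zero    = ≈-refl
  1^n≈1 (suc n) = ≈-trans (*-identityˡ _) (1^n≈1 n)

  x^m≈1∧m∣n⇒x^n≈1 : ∀ x m {n} → x ^ m ≈ 1# → m ∣ n → x ^ n ≈ 1#
  x^m≈1∧m∣n⇒x^n≈1 x m x^m≈1 (divides-refl k) = begin
    x ^ (k ℕ.* m)  ≈⟨ ^-congʳ x (ℕ.*-comm k m) ⟩
    x ^ (m ℕ.* k)  ≈⟨ ^-assocʳ x m k ⟨
    (x ^ m) ^ k    ≈⟨ ^-congˡ k x^m≈1 ⟩
    1# ^ k         ≈⟨ 1^n≈1 k ⟩
    1#             ∎

  -- Minimality is put as divisibility, the form in which orders of products and roots can be
  -- computed.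
  HasOrder : Carrier → ℕ → Set ℓ
  HasOrder x m = x ^ m ≈ 1# × (∀ j → x ^ j ≈ 1# → m ∣ j)

  -- Bézout over ℕ writes 1 + ln = km or 1 + km = ln, so x times a trivial power equals a trivial
  -- power, and no inverses are involved.
  coprime-exponents : ∀ {x m n} → Coprime m n → x ^ m ≈ 1# → x ^ n ≈ 1# → x ≈ 1#
  coprime-exponents {x} {m} {n} c x^m≈1 x^n≈1 with coprime-Bézout c
  ... | Bézout.+- k l eq = begin
    x                        ≈⟨ *-identityʳ x ⟨
    x * 1#                   ≈⟨ *-congˡ (x^m≈1∧m∣n⇒x^n≈1 x n x^n≈1 (divides-refl l)) ⟨
    x * x ^ (l ℕ.* n)        ≡⟨ cong (x ^_) eq ⟩
    x ^ (k ℕ.* m)            ≈⟨ x^m≈1∧m∣n⇒x^n≈1 x m x^m≈1 (divides-refl k) ⟩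
    1#                       ∎
  ... | Bézout.-+ k l eq = begin
    x                        ≈⟨ *-identityʳ x ⟨
    x * 1#                   ≈⟨ *-congˡ (x^m≈1∧m∣n⇒x^n≈1 x m x^m≈1 (divides-refl k)) ⟨
    x * x ^ (k ℕ.* m)        ≡⟨ cong (x ^_) eq ⟩
    x ^ (l ℕ.* n)            ≈⟨ x^m≈1∧m∣n⇒x^n≈1 x n x^n≈1 (divides-refl l) ⟩
    1#                       ∎

  -- If (xy)^j = 1, raising to the power m removes x and leaves y^(jm) = 1. Hence n divides jm and,
  -- by coprimality, j; the same holds with the roles exchanged.
  order-* : ∀ {x y m n} → Coprime m n → HasOrder x m → HasOrder y n → HasOrder (x * y) (m ℕ.* n)
  order-* {x} {y} {m} {n} coprime (x^m≈1 , m∣) (y^n≈1 , n∣) = xy^mn≈1 , mn∣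
    where
    xy^mn≈1 : (x * y) ^ (m ℕ.* n) ≈ 1#
    xy^mn≈1 = begin
      (x * y) ^ (m ℕ.* n)              ≈⟨ ^-distrib-* x y (m ℕ.* n) ⟩
      x ^ (m ℕ.* n) * y ^ (m ℕ.* n)    ≈⟨ *-cong (x^m≈1∧m∣n⇒x^n≈1 x m x^m≈1 (m∣m*n n))
                                                 (x^m≈1∧m∣n⇒x^n≈1 y n y^n≈1 (n∣m*n m)) ⟩
      1# * 1#                          ≈⟨ *-identityˡ 1# ⟩
      1#                               ∎

    drop-factor : ∀ x y m j → x ^ m ≈ 1# → (x * y) ^ j ≈ 1# → y ^ (j ℕ.* m) ≈ 1#
    drop-factor x y m j x^m≈1 xy^j≈1 = begin
      y ^ (j ℕ.* m)                    ≈⟨ *-identityˡ _ ⟨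
      1# * y ^ (j ℕ.* m)               ≈⟨ *-congʳ (x^m≈1∧m∣n⇒x^n≈1 x m x^m≈1 (n∣m*n j)) ⟨
      x ^ (j ℕ.* m) * y ^ (j ℕ.* m)    ≈⟨ ^-distrib-* x y (j ℕ.* m) ⟨
      (x * y) ^ (j ℕ.* m)              ≈⟨ x^m≈1∧m∣n⇒x^n≈1 (x * y) j xy^j≈1 (m∣m*n m) ⟩
      1#                               ∎

    mn∣ : ∀ j → (x * y) ^ j ≈ 1# → m ℕ.* n ∣ j
    mn∣ j xy^j≈1 = coprime∧∣∧∣⇒*∣ coprime
      (coprime-divisor coprime (subst (m ∣_) (ℕ.*-comm j n)
        (m∣ _ (drop-factor y x n j y^n≈1 (≈-trans (^-congˡ j (*-comm y x)) xy^j≈1)))))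
      (coprime-divisor (Coprimality.sym coprime) (subst (n ∣_) (ℕ.*-comm j m)
        (n∣ _ (drop-factor x y m j x^m≈1 xy^j≈1))))

  -- From x^j = 1 follows (x^q)^j = 1, so d divides j, and through q ∣ d so does q. Writing j = kq
  -- gives (x^q)^k = 1, so d divides k as well.
  order-root : ∀ {x q d} → q ∣ d → HasOrder (x ^ q) d → HasOrder x (q ℕ.* d)
  order-root {x} {q} {d} q∣d (x^q^d≈1 , d∣) =
    ≈-trans (≈-sym (^-assocʳ x q d)) x^q^d≈1 , λ j x^j≈1 → qd∣ j x^j≈1
      (∣-trans q∣d (d∣ j (begin
        (x ^ q) ^ j     ≈⟨ ^-assocʳ x q j ⟩
        x ^ (q ℕ.* j)   ≈⟨ x^m≈1∧m∣n⇒x^n≈1 x j x^j≈1 (n∣m*n q) ⟩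
        1#              ∎)))
    where
    qd∣ : ∀ j → x ^ j ≈ 1# → q ∣ j → q ℕ.* d ∣ j
    qd∣ _ x^j≈1 (divides-refl k) = subst (q ℕ.* d ∣_) (ℕ.*-comm q k) (*-monoʳ-∣ q (d∣ k (begin
      (x ^ q) ^ k     ≈⟨ ^-assocʳ x q k ⟩
      x ^ (q ℕ.* k)   ≡⟨ cong (x ^_) (ℕ.*-comm q k) ⟩
      x ^ (k ℕ.* q)   ≈⟨ x^j≈1 ⟩
      1#              ∎)))

  -- Induction on `e`, passing from x to x^q. In the base case an exponent j prime to q with x^j = 1
  -- would, together with x^q = 1, force x = 1.
  order-prime-power : ∀ {x q} e → Prime q → x ^ (q ℕ.^ suc e) ≈ 1# → ¬ (x ^ (q ℕ.^ e) ≈ 1#) →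
                      HasOrder x (q ℕ.^ suc e)
  order-prime-power {x} {q} zero q-prime x^q≈1 x^1≉1 = x^q≈1 , q∣
    where
    q∣ : ∀ j → x ^ j ≈ 1# → q ℕ.^ 1 ∣ j
    q∣ j x^j≈1 with q ∣? j
    ... | yes q∣j = subst (_∣ j) (sym (ℕ.*-identityʳ q)) q∣j
    ... | no  q∤j = contradiction
      (≈-trans (*-identityʳ x) (coprime-exponents {n = j} (prime∧∤⇒coprime q-prime q∤j)
         (≈-trans (^-congʳ x (sym (ℕ.*-identityʳ q))) x^q≈1) x^j≈1)) x^1≉1
  order-prime-power {x} {q} (suc e) q-prime x^≈1 x^≉1 = order-root {q = q} (m∣m*n (q ℕ.^ e))
    (order-prime-power e q-prime (≈-trans (^-assocʳ x q _) x^≈1) (x^≉1 ∘ ≈-trans (≈-sym (^-assocʳ x q _))))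

-- The ring of residues modulo n + 1

module Residues (n : ℕ) where

  open ≡.≡-Reasoning
  open RawSemiring (𝔽 (suc n)) using (_+_; _*_; 0#; 1#)

  private
    π : ℕ → Fin (suc n)
    π a = a mod suc n

  π-cong : ∀ a b → a % suc n ≡ b % suc n → π a ≡ π b
  π-cong a b eq = toℕ-injective (trans (toℕ-fromℕ< _) (trans eq (sym (toℕ-fromℕ< _))))

  π-toℕ : ∀ x → π (toℕ x) ≡ x
  π-toℕ x = toℕ-injective (trans (toℕ-fromℕ< _) (m<n⇒m%n≡m (toℕ<n x)))

  π-+ : ∀ a b → π a + π b ≡ π (a ℕ.+ b)
  π-+ a b = π-cong (toℕ (π a) ℕ.+ toℕ (π b)) (a ℕ.+ b) (trans
    (cong₂ (λ x y → (x ℕ.+ y) % suc n) (toℕ-fromℕ< (m%n<n a (suc n))) (toℕ-fromℕ< (m%n<n b (suc n))))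
    (sym (%-distribˡ-+ a b (suc n))))

  π-* : ∀ a b → π a * π b ≡ π (a ℕ.* b)
  π-* a b = π-cong (toℕ (π a) ℕ.* toℕ (π b)) (a ℕ.* b) (trans
    (cong₂ (λ x y → (x ℕ.* y) % suc n) (toℕ-fromℕ< (m%n<n a (suc n))) (toℕ-fromℕ< (m%n<n b (suc n))))
    (sym (%-distribˡ-* a b (suc n))))

  -_ : Fin (suc n) → Fin (suc n)
  - x = π (suc n ℕ.∸ toℕ x)

  private
    F : Set
    F = Fin (suc n)

    -- Every residue is `π` of its representative, so an identity need only be checked on images of
    -- naturals, where `π-+` and `π-*` reduce it to ℕ.
    lift₁ : ∀ {f g : F → F} → (∀ a → f (π a) ≡ g (π a)) → ∀ x → f x ≡ g x
    lift₁ {f} {g} eq x = subst (λ x → f x ≡ g x) (π-toℕ x) (eq (toℕ x))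

    lift₃ : ∀ {f g : F → F → F → F} → (∀ a b c → f (π a) (π b) (π c) ≡ g (π a) (π b) (π c)) →
            ∀ x y z → f x y z ≡ g x y z
    lift₃ {f} {g} eq x y z =
      lift₁ {λ x → f x y z} {λ x → g x y z} (λ a →
        lift₁ {λ y → f (π a) y z} {λ y → g (π a) y z} (λ b →
          lift₁ {f (π a) (π b)} {g (π a) (π b)} (eq a b) z) y) x

    +-assoc : ∀ x y z → (x + y) + z ≡ x + (y + z)
    +-assoc = lift₃ λ a b c → begin
      (π a + π b) + π c     ≡⟨ cong (_+ π c) (π-+ a b) ⟩
      π (a ℕ.+ b) + π c     ≡⟨ π-+ (a ℕ.+ b) c ⟩
      π (a ℕ.+ b ℕ.+ c)     ≡⟨ cong π (ℕ.+-assoc a b c) ⟩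
      π (a ℕ.+ (b ℕ.+ c))   ≡⟨ π-+ a (b ℕ.+ c) ⟨
      π a + π (b ℕ.+ c)     ≡⟨ cong (λ x → π a + x) (π-+ b c) ⟨
      π a + (π b + π c)     ∎

    *-assoc : ∀ x y z → (x * y) * z ≡ x * (y * z)
    *-assoc = lift₃ λ a b c → begin
      (π a * π b) * π c     ≡⟨ cong (_* π c) (π-* a b) ⟩
      π (a ℕ.* b) * π c     ≡⟨ π-* (a ℕ.* b) c ⟩
      π (a ℕ.* b ℕ.* c)     ≡⟨ cong π (ℕ.*-assoc a b c) ⟩
      π (a ℕ.* (b ℕ.* c))   ≡⟨ π-* a (b ℕ.* c) ⟨
      π a * π (b ℕ.* c)     ≡⟨ cong (π a *_) (π-* b c) ⟨
      π a * (π b * π c)     ∎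

    distribˡ : ∀ x y z → x * (y + z) ≡ x * y + x * z
    distribˡ = lift₃ λ a b c → begin
      π a * (π b + π c)           ≡⟨ cong (π a *_) (π-+ b c) ⟩
      π a * π (b ℕ.+ c)           ≡⟨ π-* a (b ℕ.+ c) ⟩
      π (a ℕ.* (b ℕ.+ c))         ≡⟨ cong π (ℕ.*-distribˡ-+ a b c) ⟩
      π (a ℕ.* b ℕ.+ a ℕ.* c)     ≡⟨ π-+ (a ℕ.* b) (a ℕ.* c) ⟨
      π (a ℕ.* b) + π (a ℕ.* c)   ≡⟨ cong₂ _+_ (π-* a b) (π-* a c) ⟨
      π a * π b + π a * π c       ∎

    +-comm : ∀ x y → x + y ≡ y + x
    +-comm x y = cong π (ℕ.+-comm (toℕ x) (toℕ y))

    *-comm : ∀ x y → x * y ≡ y * x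
    *-comm x y = cong π (ℕ.*-comm (toℕ x) (toℕ y))

    +-identityˡ : ∀ x → 0# + x ≡ x
    +-identityˡ = lift₁ (π-+ 0)

    *-identityˡ : ∀ x → 1# * x ≡ x
    *-identityˡ = lift₁ λ a → trans (π-* 1 a) (cong π (ℕ.*-identityˡ a))

    -‿inverseʳ : ∀ x → x + (- x) ≡ 0#
    -‿inverseʳ x = begin
      x + (- x)                               ≡⟨ cong (_+ (- x)) (π-toℕ x) ⟨
      π (toℕ x) + π (suc n ℕ.∸ toℕ x)         ≡⟨ π-+ (toℕ x) (suc n ℕ.∸ toℕ x) ⟩
      π (toℕ x ℕ.+ (suc n ℕ.∸ toℕ x))         ≡⟨ cong π (ℕ.m+[n∸m]≡n (ℕ.<⇒≤ (toℕ<n x))) ⟩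
      π (suc n)                               ≡⟨ π-cong (suc n) 0 (n%n≡0 (suc n)) ⟩
      0#                                      ∎


  commutativeRing : CommutativeRing 0ℓ 0ℓ
  commutativeRing = record
    { isCommutativeRing = record
      { isRing = record
        { +-isAbelianGroup = record
          { isGroup = record
            { isMonoid = record
              { isSemigroup = record
                { isMagma = record { isEquivalence = isEquivalence ; ∙-cong = cong₂ _+_ }
                ; assoc = +-assoc }
              ; identity = +-identityˡ , λ x → trans (+-comm x 0#) (+-identityˡ x) }
            ; inverse = (λ x → trans (+-comm (- x) x) (-‿inverseʳ x)) , -‿inverseʳ
            ; ⁻¹-cong = cong -_ }
          ; comm = +-comm }
        ; *-cong = cong₂ _*_
        ; *-assoc = *-assoc
        ; *-identity = *-identityˡ , λ x → trans (*-comm x 1#) (*-identityˡ x)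
        ; distrib = distribˡ , λ x y z → trans (*-comm (y + z) x)
            (trans (distribˡ x y z) (cong₂ _+_ (*-comm x y) (*-comm x z)))
        }
      ; *-comm = *-comm
      }
    }

  noZeroDivisors : Prime (suc n) → ∀ x y → x * y ≡ 0# → x ≡ 0# ⊎ y ≡ 0#
  noZeroDivisors p-prime x y xy≡0 = Sum.map ∣⇒≡0 ∣⇒≡0
    (euclidsLemma (toℕ x) (toℕ y) p-prime (m%n≡0⇒n∣m _ (suc n)
      (trans (sym (toℕ-fromℕ< _)) (cong toℕ xy≡0))))
    where
    ∣⇒≡0 : ∀ {x} → suc n ∣ toℕ x → x ≡ 0#
    ∣⇒≡0 {x} p∣x = toℕ-injective (trans (sym (m<n⇒m%n≡m (toℕ<n x))) (n∣m⇒m%n≡0 (toℕ x) (suc n) p∣x))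

-- A missed value could be punched out, leaving an injection of `Fin (suc n)` into `Fin n`.
injective⇒surjective : ∀ {n} {f : Fin n → Fin n} → Injective _≡_ _≡_ f → ∀ y → ∃ λ x → f x ≡ y
injective⇒surjective {suc n} {f} inj y with any? (λ x → f x Fin.≟ y)
... | yes y∈f = y∈f
... | no  y∉f = contradiction
  (injective⇒≤ {f = λ x → punchOut (y≢f x)} λ {x} {x′} → inj ∘ punchOut-injective (y≢f x) (y≢f x′)) ℕ.1+n≰n
  where
  y≢f : ∀ x → y ≢ f x
  y≢f x y≡fx = y∉f (x , sym y≡fx)

-- Finiteness supplies the inverse, so a change of variable in a sum or product needs only a proof
-- of injectivity.
injective⇒permutation : ∀ {n} {f : Fin n → Fin n} → Injective _≡_ _≡_ f → Permutation′ n
injective⇒permutation {f = f} inj = permutation f (proj₁ ∘ surj) (proj₂ ∘ surj) (λ x → inj (proj₂ (surj (f x))))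
  where
  surj = injective⇒surjective inj

-- The field with n + 1 elements

module PrimeField (n : ℕ) (p-prime : Prime (suc n)) where

  open Residues n
  open CommutativeRing commutativeRing public
    hiding (_≈_; refl; sym; trans; reflexive; zero; -_)
  open import Algebra.Properties.Ring ring using ([y-z]x≈yx-zx)
  open import Algebra.Properties.Group +-group public
    using (x∙y⁻¹≈ε⇒x≈y) renaming (∙-cancelˡ to +-cancelˡ; ∙-cancelʳ to +-cancelʳ)
  open import Algebra.Properties.CommutativeSemiring.Exp commutativeSemiring public
  open import Algebra.Properties.CommutativeMonoid.Sum *-commutativeMonoid
    using () renaming
    ( sum to ∏; sum-cong-≗ to ∏-cong; sum-permute to ∏-permute
    ; sum-replicate to ∏-replicate; ∑-distrib-+ to ∏-distrib-* )
  open ≡.≡-Reasoning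

  F : Set
  F = Carrier

  1≢0 : 1# ≢ 0#
  1≢0 = go n p-prime
    where
    go : ∀ n → Prime (suc n) → RawSemiring.1# (𝔽 (suc n)) ≢ zero
    go zero    prime[1] _ = ¬prime[1] prime[1]
    go (suc n) _        ()

  cancel : ∀ {x y z} → x * z ≡ y * z → x ≡ y ⊎ z ≡ 0#
  cancel {x} {y} {z} xz≡yz = Sum.map₁ (x∙y⁻¹≈ε⇒x≈y x y) (noZeroDivisors p-prime (x - y) z (begin
    (x - y) * z      ≡⟨ [y-z]x≈yx-zx z x y ⟩
    x * z - y * z    ≡⟨ cong (_- y * z) xz≡yz ⟩
    y * z - y * z    ≡⟨ -‿inverseʳ (y * z) ⟩
    0#               ∎))

  *-cancelʳ : ∀ {x y z} → z ≢ 0# → x * z ≡ y * z → x ≡ y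
  *-cancelʳ z≢0 xz≡yz = Sum.fromInj₁ (λ z≡0 → contradiction z≡0 z≢0) (cancel xz≡yz)

  *-cancelˡ : ∀ {x y z} → z ≢ 0# → z * x ≡ z * y → x ≡ y
  *-cancelˡ {x} {y} {z} z≢0 zx≡zy = *-cancelʳ z≢0 (trans (*-comm x z) (trans zx≡zy (*-comm z y)))

  *-≢0 : ∀ {x y} → x ≢ 0# → y ≢ 0# → x * y ≢ 0#
  *-≢0 {x} {y} x≢0 y≢0 xy≡0 = Sum.[ x≢0 , y≢0 ] (noZeroDivisors p-prime x y xy≡0)

  ^-≢0 : ∀ {x} k → x ≢ 0# → x ^ k ≢ 0#
  ^-≢0 zero    _   = 1≢0
  ^-≢0 (suc k) x≢0 = *-≢0 x≢0 (^-≢0 k x≢0)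

  dilation : ∀ {a} → a ≢ 0# → Permutation′ (suc n)
  dilation {a} a≢0 = injective⇒permutation {f = a *_} (*-cancelˡ a≢0)

  -- Multiplication by a permutes the nonzero elements, so their product absorbs a factor aⁿ.
  fermat : ∀ {a} → a ≢ 0# → a ^ n ≡ 1#
  fermat {a} a≢0 = *-cancelʳ (∏-≢0 nonzero nonzero-≢0) (begin
    a ^ n * ∏ nonzero                           ≡⟨ cong (_* ∏ nonzero) (trans (sym (∏-replicate n)) (sym (*-identityˡ _))) ⟩
    ∏ scale * ∏ nonzero                         ≡⟨ ∏-distrib-* scale nonzero ⟨
    ∏ (λ x → scale x * nonzero x)               ≡⟨ ∏-cong permuted ⟨
    ∏ (λ x → nonzero (a * x))                   ≡⟨ ∏-permute nonzero (dilation a≢0) ⟨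
    ∏ nonzero                                   ≡⟨ *-identityˡ (∏ nonzero) ⟨
    1# * ∏ nonzero                              ∎)
    where
    -- Both take the value 1 at zero, so that products over all of `F` see only the `n` nonzero
    -- elements.
    nonzero scale : F → F
    nonzero zero    = 1#
    nonzero (suc i) = suc i
    scale zero    = 1#
    scale (suc i) = a

    nonzero-≢0 : ∀ x → nonzero x ≢ 0#
    nonzero-≢0 zero    = 1≢0
    nonzero-≢0 (suc i) ()

    nonzero≡id : ∀ {x} → x ≢ 0# → nonzero x ≡ x
    nonzero≡id {zero}  0≢0 = contradiction refl 0≢0
    nonzero≡id {suc i} _   = refl

    permuted : ∀ x → nonzero (a * x) ≡ scale x * nonzero x
    permuted zero    = trans (cong nonzero (zeroʳ a)) (sym (*-identityˡ 1#))
    permuted (suc i) = nonzero≡id (*-≢0 a≢0 λ ())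

    ∏-≢0 : ∀ {k} (f : Fin k → F) → (∀ i → f i ≢ 0#) → ∏ f ≢ 0#
    ∏-≢0 {zero}  f _   = 1≢0
    ∏-≢0 {suc k} f f≢0 = *-≢0 (f≢0 zero) (∏-≢0 (f ∘ suc) (f≢0 ∘ suc))

  private
    open MonicPolynomials commutativeSemiring using (⟦_⟧; roots≤degree)

    ⟦0⟧ : ∀ k x → ⟦ Vec.replicate k 0# ⟧ x ≡ x ^ k
    ⟦0⟧ zero    x = refl
    ⟦0⟧ (suc k) x = trans (+-identityˡ _) (cong (x *_) (⟦0⟧ k x))

    x^m-1 : ∀ k → Vec F (suc k)
    x^m-1 k = - 1# ∷ Vec.replicate k 0#

  -- X^m - 1 has at most m < n roots, while there are `n` nonzero elements.
  ∃-nonroot : ∀ {m} → 0 ℕ.< m → m ℕ.< n → ∃ λ x → x ≢ 0# × x ^ m ≢ 1#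
  ∃-nonroot {suc k} _ m<n =
    let i , x^m≢1 = ¬∀⟶∃¬ n (λ i → suc i ^ suc k ≡ 1#) (λ i → suc i ^ suc k Fin.≟ 1#) ¬all-roots
    in suc i , (λ ()) , x^m≢1
    where
    root : ∀ x → x ^ suc k ≡ 1# → ⟦ x^m-1 k ⟧ x ≡ 0#
    root x x^m≡1 = begin
      - 1# + x * ⟦ Vec.replicate k 0# ⟧ x  ≡⟨ cong (λ y → - 1# + x * y) (⟦0⟧ k x) ⟩
      - 1# + x ^ suc k                     ≡⟨ cong (λ y → - 1# + y) x^m≡1 ⟩
      - 1# + 1#                            ≡⟨ -‿inverseˡ 1# ⟩
      0#                                   ∎

    ¬all-roots : ¬ (∀ i → suc i ^ suc k ≡ 1#)
    ¬all-roots roots = ℕ.<⇒≱ m<n (subst (ℕ._≤ suc k)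
      (trans (length-map suc (allFin n)) (length-tabulate {n = n} id))
      (roots≤degree cancel +-cancelˡ 1≢0 (x^m-1 k)
        (Unique.map⁺ Fin.suc-injective (Unique.allFin⁺ n))
        (All.map⁺ (All.tabulate⁺ λ i → root (suc i) (roots i)))))

-- Prime powers in a number; subsets as lists

∃-prime-divisor : ∀ {d} → 1 ℕ.< d → ∃ λ q → Prime q × q ∣ d
∃-prime-divisor {d@(suc _)} 1<d with factorise d
... | record { factors = [] ; isFactorisation = d≡1 } = contradiction (sym d≡1) (ℕ.<⇒≢ 1<d)
... | record { factors = q ∷ qs ; isFactorisation = d≡q*qs ; factorsPrime = q-prime All.∷ _ } =
  q , q-prime , subst (q ∣_) (sym d≡q*qs) (m∣m*n (product qs))

split-power : ∀ {q} → 1 ℕ.< q → ∀ d → 0 ℕ.< d → ∃₂ λ e m → d ≡ q ℕ.^ e ℕ.* m × q ∤ m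
split-power {q} 1<q = <-rec _ split
  where
  split : ∀ d → (∀ {c} → c ℕ.< d → 0 ℕ.< c → ∃₂ λ e m → c ≡ q ℕ.^ e ℕ.* m × q ∤ m) →
          0 ℕ.< d → ∃₂ λ e m → d ≡ q ℕ.^ e ℕ.* m × q ∤ m
  split d rec 0<d with q ∣? d
  ... | no  q∤d = 0 , d , sym (ℕ.*-identityˡ d) , q∤d
  ... | yes (divides-refl c@(suc _)) with e , m , c≡q^e*m , q∤m ← rec (ℕ.m<m*n c q 1<q) z<s =
    suc e , m , trans (ℕ.*-comm c q) (trans (cong (q ℕ.*_) c≡q^e*m) (sym (ℕ.*-assoc q (q ℕ.^ e) m))) , q∤m

members : ∀ {n} → Subset n → List (Fin n)
members []            = []
members (inside ∷ A)  = zero ∷ List.map suc (members A)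
members (outside ∷ A) = List.map suc (members A)

length-members : ∀ {n} (A : Subset n) → length (members A) ≡ ∣ A ∣
length-members []            = refl
length-members (inside ∷ A)  = cong suc (trans (length-map suc (members A)) (length-members A))
length-members (outside ∷ A) = trans (length-map suc (members A)) (length-members A)

∈-members : ∀ {n} {A : Subset n} {x} → x ∈ A → x ∈ᴸ members A
∈-members {A = inside ∷ A}  here        = Any.here refl
∈-members {A = inside ∷ A}  (there x∈A) = Any.there (∈-map⁺ suc (∈-members x∈A))
∈-members {A = outside ∷ A} (there x∈A) = ∈-map⁺ suc (∈-members x∈A)

length-cartesianProductWith : ∀ {A B C : Set} (f : A → B → C) xs ys →
  length (cartesianProductWith f xs ys) ≡ length xs ℕ.* length ys
length-cartesianProductWith f []       ys = refl
length-cartesianProductWith f (x ∷ xs) ys = trans (length-++ (List.map (f x) ys))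
  (cong₂ ℕ._+_ (length-map (f x) ys) (length-cartesianProductWith f xs ys))

-- Primitive roots and the lower bound

module PrimitiveRoots (n : ℕ) (p-prime : Prime (suc n)) where

  open PrimeField n p-prime
  open Orders commutativeSemiring
  open ≡.≡-Reasoning

  0<n : 0 ℕ.< n
  0<n = go n p-prime
    where
    go : ∀ n → Prime (suc n) → 0 ℕ.< n
    go zero    prime[1] = contradiction prime[1] ¬prime[1]
    go (suc n) _        = z<s

  -- For the full power q^(e+1) of a prime q in d, a non-root x of X^(n/q) - 1 yields
  -- the element x^(n/q^(e+1)) of order q^(e+1).
  ∃-order : ∀ d → d ∣ n → ∃ λ x → HasOrder x d
  ∃-order = <-rec _ step
    where
    step : ∀ d → (∀ {c} → c ℕ.< d → c ∣ n → ∃ λ x → HasOrder x c) → d ∣ n → ∃ λ x → HasOrder x d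
    step 0 _ 0∣n = contradiction (sym (0∣⇒≡0 0∣n)) (ℕ.<⇒≢ 0<n)
    step 1 _ _   = 1# , *-identityˡ 1# , λ j _ → 1∣ j
    step d@(suc (suc _)) rec d∣n@(divides t n≡td)
      with q , q-prime , q∣d ← ∃-prime-divisor {d} (s≤s z<s)
      with split-power (ℕ.nonTrivial⇒n>1 q {{prime⇒nonTrivial q-prime}}) d z<s
    ... | zero , m , d≡m , q∤m = contradiction (subst (q ∣_) (trans d≡m (ℕ.*-identityˡ m)) q∣d) q∤m
    ... | suc e , m , d≡q^e*m , q∤m = combine
      where
      instance
        q≢0 = prime⇒nonZero q-prime

      1<q : 1 ℕ.< q
      1<q = ℕ.nonTrivial⇒n>1 q {{prime⇒nonTrivial q-prime}}

      -- Since n = t m q^(e+1), this is n/q.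
      k : ℕ
      k = t ℕ.* m ℕ.* q ℕ.^ e

      n≡ : n ≡ t ℕ.* m ℕ.* q ℕ.^ suc e
      n≡ = trans n≡td (trans (cong (t ℕ.*_) d≡q^e*m) (assoc t m (q ℕ.^ suc e)))
        where
        assoc : ∀ t m a → t ℕ.* (a ℕ.* m) ≡ t ℕ.* m ℕ.* a
        assoc = solve-∀

      n≡kq : n ≡ k ℕ.* q
      n≡kq = trans n≡ (assoc (t ℕ.* m) q (q ℕ.^ e))
        where
        assoc : ∀ t q a → t ℕ.* (q ℕ.* a) ≡ t ℕ.* a ℕ.* q
        assoc = solve-∀

      0<k : 0 ℕ.< k
      0<k = ℕ.n≢0⇒n>0 λ k≡0 → ℕ.<⇒≢ 0<n (sym (trans n≡kq (cong (ℕ._* q) k≡0)))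

      k<n : k ℕ.< n
      k<n = subst (k ℕ.<_) (sym n≡kq) (ℕ.m<m*n k q {{ℕ.>-nonZero 0<k}} 1<q)

      -- The recursive call is made at `m`, the part of `d` prime to q. It is nonzero because q
      -- divides 0 but not `m`.
      m<d : m ℕ.< d
      m<d = subst (m ℕ.<_) (trans (ℕ.*-comm m _) (sym d≡q^e*m))
        (ℕ.m<m*n m (q ℕ.^ suc e) {{ℕ.≢-nonZero λ { refl → q∤m (q ∣0) }}}
          (ℕ.<-≤-trans 1<q (ℕ.m≤m*n q (q ℕ.^ e) {{ℕ.m^n≢0 q e}})))

      m∣n : m ∣ n
      m∣n = ∣-trans (subst (m ∣_) (sym d≡q^e*m) (n∣m*n (q ℕ.^ suc e))) d∣n

      combine : ∃ λ x → HasOrder x d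
      combine =
        let x , x≢0 , x^k≢1 = ∃-nonroot 0<k k<n
            y , order-y     = rec m<d m∣n
            tm              = t ℕ.* m
            -- The power q^(e+1) of x^(tm) is x^n, which is 1 by Fermat; its power q^e is x^k, which
            -- is not 1.
            order-x^tm      = order-prime-power e q-prime
              (trans (^-assocʳ x tm (q ℕ.^ suc e)) (trans (cong (x ^_) (sym n≡)) (fermat x≢0)))
              (x^k≢1 ∘ trans (sym (^-assocʳ x tm (q ℕ.^ e))))
        in x ^ tm * y , subst (HasOrder (x ^ tm * y)) (sym d≡q^e*m)
             (order-* (coprime-^ (suc e) (prime∧∤⇒coprime q-prime q∤m)) order-x^tm order-y)

  module _ {g} (order-g : HasOrder g n) where

    order⇒≢0 : g ≢ 0#
    order⇒≢0 g≡0 = 0^n≢1 n 0<n (subst (λ x → x ^ n ≡ 1#) g≡0 (proj₁ order-g))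
      where
      0^n≢1 : ∀ n → 0 ℕ.< n → 0# ^ n ≢ 1#
      0^n≢1 (suc n) _ 0^n≡1 = 1≢0 (trans (sym 0^n≡1) (zeroˡ (0# ^ n)))

    -- Equality would give g^(j-i) = 1 with 0 < j - i < n. Bounding the gap instead of the exponents
    -- covers both 0, ..., n - 1 and 1, ..., n, the range used by `φ`.
    powers-distinct : ∀ {i j} → i ℕ.< j → j ℕ.< i ℕ.+ n → g ^ i ≢ g ^ j
    powers-distinct {i} {j} i<j j<i+n g^i≡g^j = >⇒∤ {{ℕ.>-nonZero (ℕ.m<n⇒0<n∸m i<j)}}
      (ℕ.m<n+o⇒m∸n<o j i {{ℕ.>-nonZero 0<n}} j<i+n)
      (proj₂ order-g (j ℕ.∸ i) (*-cancelˡ (^-≢0 i order⇒≢0) (begin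
        g ^ i * g ^ (j ℕ.∸ i)    ≡⟨ ^-homo-* g i (j ℕ.∸ i) ⟨
        g ^ (i ℕ.+ (j ℕ.∸ i))    ≡⟨ cong (g ^_) (ℕ.m+[n∸m]≡n (ℕ.<⇒≤ i<j)) ⟩
        g ^ j                    ≡⟨ g^i≡g^j ⟨
        g ^ i                    ≡⟨ *-identityʳ (g ^ i) ⟨
        g ^ i * 1#               ∎)))

    -- If some nonzero x were missed, then 0, x and the `n` powers of `g` would be n + 2 distinct
    -- elements among n + 1.
    order⇒primitive : IsPrimitive g
    order⇒primitive = order⇒≢0 , λ x x≢0 → power x x≢0
      where
      powers : List F
      powers = applyUpTo (g ^_) n

      power : ∀ x → x ≢ 0# → ∃ λ k → x ≡ g ^ k
      power x x≢0 with ∈ᴸ-dec Fin._≟_ x powers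
      ... | yes x∈powers = let k , _ , x≡g^k = ∈-applyUpTo⁻ (g ^_) x∈powers in k , x≡g^k
      ... | no  x∉powers = contradiction
        (subst₂ ℕ._≤_ (cong (2 ℕ.+_) (length-applyUpTo (g ^_) n)) (length-tabulate {n = suc n} id)
          (Unique∧⊆⇒length≤ unique (λ {y} _ → ∈-allFin y)))
        ℕ.1+n≰n
        where
        unique : Unique (0# ∷ x ∷ powers)
        unique = (x≢0 ∘ sym All.∷ All.applyUpTo⁺₂ (g ^_) n (λ k 0≡g^k → ^-≢0 k order⇒≢0 (sym 0≡g^k)))
          ∷ All.¬Any⇒All¬ powers x∉powers
          ∷ AllPairs.applyUpTo⁺₁ (g ^_) n (λ {i} i<j j<n → powers-distinct i<j (ℕ.<-≤-trans j<n (ℕ.m≤n+m n i)))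

    order-power : ∀ {k} → Coprime k n → HasOrder (g ^ k) n
    order-power {k} coprime =
      trans (^-assocʳ g k n) (x^m≈1∧m∣n⇒x^n≈1 g n (proj₁ order-g) (n∣m*n k)) ,
      λ j g^k^j≡1 → coprime-divisor (Coprimality.sym coprime)
        (proj₂ order-g (k ℕ.* j) (trans (sym (^-assocʳ g k j)) g^k^j≡1))

  φ≤∣A∣*∣B∣ : (A B : Subset (suc n)) → IsPrimitive ⊆ᵁ A +ˢ B → φ n ℕ.≤ ∣ A ∣ ℕ.* ∣ B ∣
  φ≤∣A∣*∣B∣ A B primitive⊆ with g , order-g ← ∃-order n ∣-refl =
    subst₂ ℕ._≤_ (length-map (g ^_) exponents)
      (trans (length-cartesianProductWith _+_ (members A) (members B))
        (cong₂ ℕ._*_ (length-members A) (length-members B)))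
      (Unique∧⊆⇒length≤ unique ⊆sums)
    where
    -- This is the list whose length defines `φ n`, so the count agrees by definition.
    exponents : List ℕ
    exponents = filter (λ k → coprime? k n) (applyUpTo suc n)

    unique : Unique (List.map (g ^_) exponents)
    unique = AllPairs.map⁺ (AllPairs.filter⁺ (λ k → coprime? k n) (AllPairs.applyUpTo⁺₁ suc n
      λ {i} i<j j<n → powers-distinct order-g (s≤s i<j) (s≤s (ℕ.<-≤-trans j<n (ℕ.m≤n+m n i)))))

    ⊆sums : ∀ {x} → x ∈ᴸ List.map (g ^_) exponents → x ∈ᴸ cartesianProductWith _+_ (members A) (members B)
    ⊆sums x∈ with k , k∈ , refl ← ∈-map⁻ (g ^_) x∈
      with _ , k⊥n ← ∈-filter⁻ (λ k → coprime? k n) {xs = applyUpTo suc n} k∈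
      with a , b , a∈A , b∈B , g^k≡a+b ← primitive⊆ (order⇒primitive (order-power order-g k⊥n)) =
      subst (_∈ᴸ cartesianProductWith _+_ (members A) (members B)) (sym g^k≡a+b)
        (∈-cartesianProductWith⁺ _+_ (∈-members a∈A) (∈-members b∈B))

-- Integer sums over finite index sets

sum-mono-≤ : ∀ {m} {f g : Fin m → ℤ} → (∀ i → f i ℤ.≤ g i) → sum f ℤ.≤ sum g
sum-mono-≤ {zero}  f≤g = ℤ.≤-refl
sum-mono-≤ {suc m} f≤g = ℤ.+-mono-≤ (f≤g zero) (sum-mono-≤ (f≤g ∘ suc))

sum-const : ∀ m i → sum {m} (λ _ → i) ≡ + m ℤ.* i
sum-const zero    i = sym (ℤ.*-zeroˡ i)
sum-const (suc m) i = trans (cong (λ j → i ℤ.+ j) (sum-const m i)) (sym (ℤ.suc-* (+ m) i))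

-- The Kronecker delta, by recursion on both indices so that `sum-δ` can follow the recursion of
-- `sum`.
δ : ∀ {m} → Fin m → Fin m → ℤ
δ zero    zero    = 1ℤ
δ zero    (suc _) = 0ℤ
δ (suc _) zero    = 0ℤ
δ (suc i) (suc j) = δ i j

δ-diag : ∀ {m} (i : Fin m) → δ i i ≡ 1ℤ
δ-diag zero    = refl
δ-diag (suc i) = δ-diag i

δ-off-diag : ∀ {m} {i j : Fin m} → i ≢ j → δ i j ≡ 0ℤ
δ-off-diag {i = zero}  {zero}  0≢0 = contradiction refl 0≢0
δ-off-diag {i = zero}  {suc j} _   = refl
δ-off-diag {i = suc i} {zero}  _   = refl
δ-off-diag {i = suc i} {suc j} i≢j = δ-off-diag (i≢j ∘ cong suc)

sum-δ : ∀ {m} (f : Fin m → ℤ) i → sum (λ j → f j ℤ.* δ i j) ≡ f i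
sum-δ {suc m} f zero = trans
  (cong₂ ℤ._+_ (ℤ.*-identityʳ (f zero))
    (trans (sum-cong-≗ (λ j → ℤ.*-zeroʳ (f (suc j)))) (trans (sum-const m 0ℤ) (ℤ.*-zeroʳ (+ m)))))
  (ℤ.+-identityʳ (f zero))
sum-δ {suc m} f (suc i) = trans (cong₂ ℤ._+_ (ℤ.*-zeroʳ (f zero)) (sum-δ (f ∘ suc) i)) (ℤ.+-identityˡ (f (suc i)))

indicator : ∀ {m} → Subset m → Fin m → ℤ
indicator A i = if lookup A i then 1ℤ else 0ℤ

sum-indicator : ∀ {m} (A : Subset m) → sum (indicator A) ≡ + ∣ A ∣
sum-indicator []            = refl
sum-indicator (inside ∷ A)  = cong (λ i → 1ℤ ℤ.+ i) (sum-indicator A)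
sum-indicator (outside ∷ A) = trans (ℤ.+-identityˡ _) (sum-indicator A)

indicator-cases : ∀ {m} (A : Subset m) i → (i ∈ A × indicator A i ≡ 1ℤ) ⊎ indicator A i ≡ 0ℤ
indicator-cases A i with lookup A i in eq
... | true  = inj₁ (lookup⇒[]= i A eq , refl)
... | false = inj₂ refl

0≤i*i : ∀ i → 0ℤ ℤ.≤ i ℤ.* i
0≤i*i (+ m)    = subst (0ℤ ℤ.≤_) (ℤ.pos-* m m) (+≤+ z≤n)
0≤i*i -[1+ m ] = +≤+ z≤n

i≡-i⇒i≡0 : ∀ i → i ≡ -1ℤ ℤ.* i → i ≡ 0ℤ
i≡-i⇒i≡0 (+ zero) _ = refl

2∣n⊎2∣1+n : ∀ n → (2 ∣ n) ⊎ (2 ∣ suc n)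
2∣n⊎2∣1+n zero = inj₁ (2 ∣0)
2∣n⊎2∣1+n (suc n) with 2∣n⊎2∣1+n n
... | inj₁ 2∣n   = inj₂ (∣m∣n⇒∣m+n ∣-refl 2∣n)
... | inj₂ 2∣1+n = inj₁ 2∣1+n

-- The quadratic character and the upper bound

module QuadraticCharacter (h : ℕ) (p-prime : Prime (suc (h ℕ.* 2))) where

  n p : ℕ
  n = h ℕ.* 2
  p = suc n

  open PrimeField n p-prime
  open import Algebra.Properties.AbelianGroup +-abelianGroup using (xyx⁻¹≈y)
  open PrimitiveRoots n p-prime using (0<n)
  open ≡.≡-Reasoning

  0<h : 0 ℕ.< h
  0<h = ℕ.n≢0⇒n>0 λ h≡0 → ℕ.<⇒≢ 0<n (sym (cong (ℕ._* 2) h≡0))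

  h<n : h ℕ.< n
  h<n = ℕ.m<m*n h 2 {{ℕ.>-nonZero 0<h}} (s≤s (s≤s z≤n))

  private
    sign : ∀ {x} → Dec (x ≡ 0#) → Dec (x ^ h ≡ 1#) → ℤ
    sign (yes _) _       = 0ℤ
    sign (no _)  (yes _) = 1ℤ
    sign (no _)  (no _)  = -1ℤ

  -- The Legendre symbol by Euler's criterion, with `h` = (p - 1)/2.
  χ : F → ℤ
  χ x = sign (x Fin.≟ 0#) (x ^ h Fin.≟ 1#)

  χ-residue : ∀ {x} → x ≢ 0# → x ^ h ≡ 1# → χ x ≡ 1ℤ
  χ-residue {x} x≢0 x^h≡1 with x Fin.≟ 0# | x ^ h Fin.≟ 1#
  ... | yes x≡0 | _          = contradiction x≡0 x≢0
  ... | no _    | yes _      = refl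
  ... | no _    | no  x^h≢1  = contradiction x^h≡1 x^h≢1

  χ-nonresidue : ∀ {x} → x ≢ 0# → x ^ h ≢ 1# → χ x ≡ -1ℤ
  χ-nonresidue {x} x≢0 x^h≢1 with x Fin.≟ 0# | x ^ h Fin.≟ 1#
  ... | yes x≡0 | _          = contradiction x≡0 x≢0
  ... | no _    | yes x^h≡1  = contradiction x^h≡1 x^h≢1
  ... | no _    | no  _      = refl

  private
    -- y² = 1 gives y(y + 1) = 1(y + 1), so either y = 1 or the common factor vanishes.
    square-root-of-1 : ∀ {y} → y * y ≡ 1# → y ≢ 1# → y + 1# ≡ 0#
    square-root-of-1 {y} y²≡1 y≢1 = Sum.fromInj₂ (λ y≡1 → contradiction y≡1 y≢1) (cancel (begin
        y * (y + 1#)    ≡⟨ distribˡ y y 1# ⟩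
        y * y + y * 1#  ≡⟨ cong₂ _+_ y²≡1 (*-identityʳ y) ⟩
        1# + y          ≡⟨ +-comm 1# y ⟩
        y + 1#          ≡⟨ *-identityˡ (y + 1#) ⟨
        1# * (y + 1#)   ∎))

    x^h*x^h≡1 : ∀ {x} → x ≢ 0# → x ^ h * x ^ h ≡ 1#
    x^h*x^h≡1 {x} x≢0 = begin
      x ^ h * x ^ h     ≡⟨ ^-homo-* x h h ⟨
      x ^ (h ℕ.+ h)     ≡⟨ cong (x ^_) (trans (cong (h ℕ.+_) (sym (ℕ.+-identityʳ h))) (ℕ.*-comm 2 h)) ⟩
      x ^ n             ≡⟨ fermat x≢0 ⟩
      1#                ∎

  χ-* : ∀ x y → χ (x * y) ≡ χ x ℤ.* χ y
  χ-* x y with x Fin.≟ 0# | y Fin.≟ 0#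
  ... | yes refl | _ = cong χ (zeroˡ y)
  ... | no _ | yes refl = trans (cong χ (zeroʳ x)) (sym (ℤ.*-zeroʳ (sign (no _) (x ^ h Fin.≟ 1#))))
  ... | no x≢0 | no y≢0 with x ^ h Fin.≟ 1# | y ^ h Fin.≟ 1#
  ...   | yes x^h≡1 | yes y^h≡1 = χ-residue (*-≢0 x≢0 y≢0)
    (trans (^-distrib-* x y h) (trans (cong₂ _*_ x^h≡1 y^h≡1) (*-identityˡ 1#)))
  ...   | yes x^h≡1 | no  y^h≢1 = χ-nonresidue (*-≢0 x≢0 y≢0)
    (y^h≢1 ∘ trans (sym (trans (^-distrib-* x y h) (trans (cong (_* y ^ h) x^h≡1) (*-identityˡ _)))))
  ...   | no  x^h≢1 | yes y^h≡1 = χ-nonresidue (*-≢0 x≢0 y≢0)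
    (x^h≢1 ∘ trans (sym (trans (^-distrib-* x y h) (trans (cong (x ^ h *_) y^h≡1) (*-identityʳ _)))))
  -- Both powers are square roots of 1 other than 1, hence equal, and their product is the square of
  -- one of them.
  ...   | no  x^h≢1 | no  y^h≢1 = χ-residue (*-≢0 x≢0 y≢0) (begin
    (x * y) ^ h       ≡⟨ ^-distrib-* x y h ⟩
    x ^ h * y ^ h     ≡⟨ cong (x ^ h *_) (+-cancelʳ 1# (y ^ h) (x ^ h) (trans
                           (square-root-of-1 (x^h*x^h≡1 y≢0) y^h≢1) (sym (square-root-of-1 (x^h*x^h≡1 x≢0) x^h≢1)))) ⟩
    x ^ h * x ^ h     ≡⟨ x^h*x^h≡1 x≢0 ⟩
    1#                ∎)

  χ-square : ∀ {x} → x ≢ 0# → χ x ℤ.* χ x ≡ 1ℤ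
  χ-square {x} x≢0 with x Fin.≟ 0# | x ^ h Fin.≟ 1#
  ... | yes x≡0 | _     = contradiction x≡0 x≢0
  ... | no _    | yes _ = refl
  ... | no _    | no _  = refl

  χ-1 : χ 1# ≡ 1ℤ
  χ-1 = χ-residue 1≢0 (1^n≈1 h)
    where open Orders commutativeSemiring

  -- If g^h were 1, every power of `g`, hence every nonzero x, would satisfy x^h = 1, against h < n.
  χ-primitive : ∀ {g} → IsPrimitive g → χ g ≡ -1ℤ
  χ-primitive {g} (g≢0 , powers) = χ-nonresidue g≢0 λ g^h≡1 →
    let x , x≢0 , x^h≢1 = ∃-nonroot 0<h h<n
        k , x≡g^k       = powers x x≢0
    in x^h≢1 (trans (cong (_^ h) x≡g^k) (trans (^-assocʳ g k h) (x^m≈1∧m∣n⇒x^n≈1 g h g^h≡1 (n∣m*n k))))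
    where open Orders commutativeSemiring

  -- Substituting ux for x with a nonresidue u permutes the terms and negates the sum.
  sum-χ : sum χ ≡ 0ℤ
  sum-χ = let u , u≢0 , u^h≢1 = ∃-nonroot 0<h h<n in i≡-i⇒i≡0 (sum χ) (begin
    sum χ                      ≡⟨ sum-permute χ (dilation u≢0) ⟩
    sum (λ x → χ (u * x))      ≡⟨ sum-cong-≗ (λ x → trans (χ-* u x) (cong (ℤ._* χ x) (χ-nonresidue u≢0 u^h≢1))) ⟩
    sum (λ x → -1ℤ ℤ.* χ x)    ≡⟨ *-distribˡ-sum -1ℤ χ ⟨
    -1ℤ ℤ.* sum χ              ∎)

  infix 8 _⁻¹
  -- The inverse by Fermat, x^(p-2). As a total function with 0⁻¹ = 0 it is injective on all of `F`,
  -- which makes x ↦ 1 + c/x a permutation for c ≠ 0.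
  _⁻¹ : F → F
  x ⁻¹ = x ^ ℕ.pred n

  0⁻¹≡0 : 0# ⁻¹ ≡ 0#
  0⁻¹≡0 = go (ℕ.pred n) (ℕ.pred-mono-≤ (ℕ.*-monoˡ-≤ 2 0<h))
    where
    go : ∀ k → 0 ℕ.< k → 0# ^ k ≡ 0#
    go (suc k) _ = zeroˡ (0# ^ k)

  ⁻¹-inverse : ∀ {x} → x ≢ 0# → x * x ⁻¹ ≡ 1#
  ⁻¹-inverse {x} x≢0 = trans (cong (x ^_) (ℕ.suc-pred n {{ℕ.>-nonZero 0<n}})) (fermat x≢0)

  ⁻¹-≢0 : ∀ {x} → x ≢ 0# → x ⁻¹ ≢ 0#
  ⁻¹-≢0 = ^-≢0 (ℕ.pred n)

  ⁻¹-injective : ∀ {x y} → x ⁻¹ ≡ y ⁻¹ → x ≡ y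
  ⁻¹-injective {x} {y} x⁻¹≡y⁻¹ with x Fin.≟ 0# | y Fin.≟ 0#
  ... | yes refl | yes refl = refl
  ... | yes refl | no y≢0   = contradiction (trans (sym x⁻¹≡y⁻¹) 0⁻¹≡0) (⁻¹-≢0 y≢0)
  ... | no x≢0   | yes refl = contradiction (trans x⁻¹≡y⁻¹ 0⁻¹≡0) (⁻¹-≢0 x≢0)
  ... | no x≢0   | no y≢0   = *-cancelʳ (⁻¹-≢0 x≢0) (begin
    x * x ⁻¹   ≡⟨ ⁻¹-inverse x≢0 ⟩
    1#         ≡⟨ ⁻¹-inverse y≢0 ⟨
    y * y ⁻¹   ≡⟨ cong (y *_) x⁻¹≡y⁻¹ ⟨
    y * x ⁻¹   ∎)

  translation : F → Permutation′ p
  translation a = injective⇒permutation {f = λ x → a + x} (+-cancelˡ a _ _)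

  1+c/x : ∀ {c} → c ≢ 0# → Permutation′ p
  1+c/x {c} c≢0 = injective⇒permutation {f = λ x → 1# + c * x ⁻¹}
    (⁻¹-injective ∘ *-cancelˡ c≢0 ∘ +-cancelˡ 1# _ _)

  -- x(x + c) = x²(1 + c/x) for x ≢ 0, and 0⁻¹ ≡ 0 leaves a defect of 1 at x ≡ 0.
  χ-shift : ∀ c x → χ x ℤ.* χ (x + c) ≡ χ (1# + c * x ⁻¹) ℤ.+ -1ℤ ℤ.* δ 0# x
  χ-shift c x = shift (x Fin.≟ 0#)
    where
    shift : Dec (x ≡ 0#) → χ x ℤ.* χ (x + c) ≡ χ (1# + c * x ⁻¹) ℤ.+ -1ℤ ℤ.* δ 0# x
    shift (yes refl) = sym (cong (ℤ._+ -1ℤ) (begin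
      χ (1# + c * 0# ⁻¹)  ≡⟨ cong (λ y → χ (1# + c * y)) 0⁻¹≡0 ⟩
      χ (1# + c * 0#)     ≡⟨ cong (λ y → χ (1# + y)) (zeroʳ c) ⟩
      χ (1# + 0#)         ≡⟨ cong χ (+-identityʳ 1#) ⟩
      χ 1#                ≡⟨ χ-1 ⟩
      1ℤ                  ∎))
    shift (no x≢0) = begin
      χ x ℤ.* χ (x + c)                           ≡⟨ cong (λ y → χ x ℤ.* χ y) x+c ⟩
      χ x ℤ.* χ (x * (1# + c * x ⁻¹))             ≡⟨ cong (χ x ℤ.*_) (χ-* x (1# + c * x ⁻¹)) ⟩
      χ x ℤ.* (χ x ℤ.* χ (1# + c * x ⁻¹))         ≡⟨ ℤ.*-assoc (χ x) (χ x) (χ (1# + c * x ⁻¹)) ⟨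
      χ x ℤ.* χ x ℤ.* χ (1# + c * x ⁻¹)           ≡⟨ cong (ℤ._* χ (1# + c * x ⁻¹)) (χ-square x≢0) ⟩
      1ℤ ℤ.* χ (1# + c * x ⁻¹)                    ≡⟨ ℤ.*-identityˡ (χ (1# + c * x ⁻¹)) ⟩
      χ (1# + c * x ⁻¹)                           ≡⟨ ℤ.+-identityʳ (χ (1# + c * x ⁻¹)) ⟨
      χ (1# + c * x ⁻¹) ℤ.+ -1ℤ ℤ.* 0ℤ            ≡⟨ cong (λ d → χ (1# + c * x ⁻¹) ℤ.+ -1ℤ ℤ.* d) (δ-off-diag (x≢0 ∘ sym)) ⟨
      χ (1# + c * x ⁻¹) ℤ.+ -1ℤ ℤ.* δ 0# x        ∎
      where
      x+c : x + c ≡ x * (1# + c * x ⁻¹)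
      x+c = sym (begin
        x * (1# + c * x ⁻¹)      ≡⟨ distribˡ x 1# (c * x ⁻¹) ⟩
        x * 1# + x * (c * x ⁻¹)  ≡⟨ cong₂ _+_ (*-identityʳ x) (cong (x *_) (*-comm c (x ⁻¹))) ⟩
        x + x * (x ⁻¹ * c)       ≡⟨ cong (λ y → x + y) (*-assoc x (x ⁻¹) c) ⟨
        x + x * x ⁻¹ * c         ≡⟨ cong (λ y → x + y * c) (⁻¹-inverse x≢0) ⟩
        x + 1# * c               ≡⟨ cong (λ y → x + y) (*-identityˡ c) ⟩
        x + c                    ∎)

  -- Translating by `a` leaves the shift c = b - a, and `χ-shift` applies. For c = 0 every main term
  -- is χ(1) = 1; otherwise they are a rearrangement of the terms of `sum χ`. The defect at zero
  -- contributes the -1.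
  autocorrelation : ∀ a b → sum (λ x → χ (a + x) ℤ.* χ (b + x)) ≡ + p ℤ.* δ a b ℤ.+ -1ℤ
  autocorrelation a b = begin
    sum (λ x → χ (a + x) ℤ.* χ (b + x))                       ≡⟨ sum-cong-≗ (λ x → cong (λ y → χ (a + x) ℤ.* χ y) (b+x x)) ⟩
    sum (λ x → χ (a + x) ℤ.* χ (a + x + (b - a)))             ≡⟨ sum-permute (λ x → χ x ℤ.* χ (x + (b - a))) (translation a) ⟨
    sum (λ x → χ x ℤ.* χ (x + (b - a)))                       ≡⟨ sum-cong-≗ (χ-shift (b - a)) ⟩
    sum (λ x → χ (1# + (b - a) * x ⁻¹) ℤ.+ -1ℤ ℤ.* δ 0# x)    ≡⟨ ∑-distrib-+ (λ x → χ (1# + (b - a) * x ⁻¹)) (λ x → -1ℤ ℤ.* δ 0# x) ⟩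
    sum (λ x → χ (1# + (b - a) * x ⁻¹)) ℤ.+ sum (λ x → -1ℤ ℤ.* δ 0# x)
      ≡⟨ cong₂ ℤ._+_ main (sum-δ (λ _ → -1ℤ) 0#) ⟩
    + p ℤ.* δ a b ℤ.+ -1ℤ                                     ∎
    where
    b+x : ∀ x → b + x ≡ a + x + (b - a)
    b+x x = sym (begin
      a + x + (b - a)      ≡⟨ cong (_+ (b - a)) (+-comm a x) ⟩
      x + a + (b - a)      ≡⟨ +-assoc x a (b - a) ⟩
      x + (a + (b - a))    ≡⟨ cong (λ y → x + y) (+-assoc a b _) ⟨
      x + (a + b - a)      ≡⟨ cong (λ y → x + y) (xyx⁻¹≈y a b) ⟩
      x + b                ≡⟨ +-comm x b ⟩
      b + x                ∎)

    1+0*y : ∀ y → 1# + (a - a) * y ≡ 1#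
    1+0*y y = trans (cong (λ z → 1# + z) (trans (cong (_* y) (-‿inverseʳ a)) (zeroˡ y))) (+-identityʳ 1#)

    main : sum (λ x → χ (1# + (b - a) * x ⁻¹)) ≡ + p ℤ.* δ a b
    main with a Fin.≟ b
    ... | yes refl = begin
      sum (λ x → χ (1# + (a - a) * x ⁻¹))   ≡⟨ sum-cong-≗ (λ x → trans (cong χ (1+0*y (x ⁻¹))) χ-1) ⟩
      sum {p} (λ _ → 1ℤ)                    ≡⟨ sum-const p 1ℤ ⟩
      + p ℤ.* 1ℤ                            ≡⟨ cong (+ p ℤ.*_) (δ-diag a) ⟨
      + p ℤ.* δ a a                         ∎
    ... | no a≢b = begin
      sum (λ x → χ (1# + (b - a) * x ⁻¹))   ≡⟨ sum-permute χ (1+c/x (λ b-a≡0 → a≢b (sym (x∙y⁻¹≈ε⇒x≈y b a b-a≡0)))) ⟨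
      sum χ                                 ≡⟨ sum-χ ⟩
      0ℤ                                    ≡⟨ ℤ.*-zeroʳ (+ p) ⟨
      + p ℤ.* 0ℤ                            ≡⟨ cong (+ p ℤ.*_) (δ-off-diag a≢b) ⟨
      + p ℤ.* δ a b                         ∎

  module _ (A B : Subset p) where

    w : F → ℤ
    w = indicator A

    ∣A∣ : ℤ
    ∣A∣ = + ∣ A ∣

    -- Indicator weights replace a sum over the subset, so that exchanging sums stays within double
    -- sums over `F`.
    T : F → ℤ
    T x = sum (λ a → w a ℤ.* χ (a + x))

    -- Expanding `T` and exchanging the sums leaves Σ_b w(b)(p δ(a, b) - 1): the diagonal gives p
    -- w(a), the constant -|A|.
    sum-χT : ∀ a → sum (λ x → χ (a + x) ℤ.* T x) ≡ + p ℤ.* w a ℤ.- ∣A∣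
    sum-χT a = begin
      sum (λ x → χ (a + x) ℤ.* T x)
        ≡⟨ sum-cong-≗ (λ x → *-distribˡ-sum (χ (a + x)) (λ b → w b ℤ.* χ (b + x))) ⟩
      sum (λ x → sum (λ b → χ (a + x) ℤ.* (w b ℤ.* χ (b + x))))
        ≡⟨ ∑-comm (λ x b → χ (a + x) ℤ.* (w b ℤ.* χ (b + x))) ⟩
      sum (λ b → sum (λ x → χ (a + x) ℤ.* (w b ℤ.* χ (b + x))))
        ≡⟨ sum-cong-≗ inner ⟩
      sum (λ b → + p ℤ.* (w b ℤ.* δ a b) ℤ.+ -1ℤ ℤ.* w b)
        ≡⟨ ∑-distrib-+ (λ b → + p ℤ.* (w b ℤ.* δ a b)) (λ b → -1ℤ ℤ.* w b) ⟩
      sum (λ b → + p ℤ.* (w b ℤ.* δ a b)) ℤ.+ sum (λ b → -1ℤ ℤ.* w b)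
        ≡⟨ cong₂ ℤ._+_ (*-distribˡ-sum (+ p) (λ b → w b ℤ.* δ a b)) (*-distribˡ-sum -1ℤ w) ⟨
      + p ℤ.* sum (λ b → w b ℤ.* δ a b) ℤ.+ -1ℤ ℤ.* sum w
        ≡⟨ cong₂ (λ i j → + p ℤ.* i ℤ.+ j) (sum-δ w a) (trans (cong (-1ℤ ℤ.*_) (sum-indicator A)) (ℤ.-1*i≡-i ∣A∣)) ⟩
      + p ℤ.* w a ℤ.- ∣A∣  ∎
      where
      regroup : ∀ i j k → i ℤ.* (j ℤ.* k) ≡ j ℤ.* (i ℤ.* k)
      regroup = ℤ-Solver.solve-∀

      expand : ∀ i q d → i ℤ.* (q ℤ.* d ℤ.+ -1ℤ) ≡ q ℤ.* (i ℤ.* d) ℤ.+ -1ℤ ℤ.* i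
      expand = ℤ-Solver.solve-∀

      inner : ∀ b → sum (λ x → χ (a + x) ℤ.* (w b ℤ.* χ (b + x))) ≡ + p ℤ.* (w b ℤ.* δ a b) ℤ.+ -1ℤ ℤ.* w b
      inner b = begin
        sum (λ x → χ (a + x) ℤ.* (w b ℤ.* χ (b + x)))   ≡⟨ sum-cong-≗ (λ x → regroup (χ (a + x)) (w b) (χ (b + x))) ⟩
        sum (λ x → w b ℤ.* (χ (a + x) ℤ.* χ (b + x)))   ≡⟨ *-distribˡ-sum (w b) (λ x → χ (a + x) ℤ.* χ (b + x)) ⟨
        w b ℤ.* sum (λ x → χ (a + x) ℤ.* χ (b + x))     ≡⟨ cong (w b ℤ.*_) (autocorrelation a b) ⟩
        w b ℤ.* (+ p ℤ.* δ a b ℤ.+ -1ℤ)                 ≡⟨ expand (w b) (+ p) (δ a b) ⟩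
        + p ℤ.* (w b ℤ.* δ a b) ℤ.+ -1ℤ ℤ.* w b         ∎

    -- Only one factor `T x` is expanded; the other stays whole for `sum-χT`.
    sum-T² : sum (λ x → T x ℤ.* T x) ≡ + p ℤ.* ∣A∣ ℤ.- ∣A∣ ℤ.* ∣A∣
    sum-T² = begin
      sum (λ x → T x ℤ.* T x)
        ≡⟨ sum-cong-≗ (λ x → *-distribʳ-sum (T x) (λ a → w a ℤ.* χ (a + x))) ⟩
      sum (λ x → sum (λ a → w a ℤ.* χ (a + x) ℤ.* T x))
        ≡⟨ ∑-comm (λ x a → w a ℤ.* χ (a + x) ℤ.* T x) ⟩
      sum (λ a → sum (λ x → w a ℤ.* χ (a + x) ℤ.* T x))
        ≡⟨ sum-cong-≗ inner ⟩
      sum (λ a → w a ℤ.* (+ p ℤ.- ∣A∣))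
        ≡⟨ *-distribʳ-sum (+ p ℤ.- ∣A∣) w ⟨
      sum w ℤ.* (+ p ℤ.- ∣A∣)
        ≡⟨ cong (ℤ._* (+ p ℤ.- ∣A∣)) (sum-indicator A) ⟩
      ∣A∣ ℤ.* (+ p ℤ.- ∣A∣)
        ≡⟨ expand (+ p) ∣A∣ ⟩
      + p ℤ.* ∣A∣ ℤ.- ∣A∣ ℤ.* ∣A∣  ∎
      where
      expand : ∀ q i → i ℤ.* (q ℤ.- i) ≡ q ℤ.* i ℤ.- i ℤ.* i
      expand = ℤ-Solver.solve-∀

      -- The weights are 0 or 1, so w(a)² = w(a).
      idempotent : ∀ a → w a ℤ.* (+ p ℤ.* w a ℤ.- ∣A∣) ≡ w a ℤ.* (+ p ℤ.- ∣A∣)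
      idempotent a with indicator-cases A a
      ... | inj₁ (_ , wa≡1) = cong (λ i → w a ℤ.* (i ℤ.- ∣A∣)) (trans (cong (+ p ℤ.*_) wa≡1) (ℤ.*-identityʳ (+ p)))
      ... | inj₂ wa≡0 = trans (cong (ℤ._* (+ p ℤ.* w a ℤ.- ∣A∣)) wa≡0) (sym (cong (ℤ._* (+ p ℤ.- ∣A∣)) wa≡0))

      inner : ∀ a → sum (λ x → w a ℤ.* χ (a + x) ℤ.* T x) ≡ w a ℤ.* (+ p ℤ.- ∣A∣)
      inner a = begin
        sum (λ x → w a ℤ.* χ (a + x) ℤ.* T x)       ≡⟨ sum-cong-≗ (λ x → ℤ.*-assoc (w a) (χ (a + x)) (T x)) ⟩
        sum (λ x → w a ℤ.* (χ (a + x) ℤ.* T x))     ≡⟨ *-distribˡ-sum (w a) (λ x → χ (a + x) ℤ.* T x) ⟨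
        w a ℤ.* sum (λ x → χ (a + x) ℤ.* T x)       ≡⟨ cong (w a ℤ.*_) (sum-χT a) ⟩
        w a ℤ.* (+ p ℤ.* w a ℤ.- ∣A∣)               ≡⟨ idempotent a ⟩
        w a ℤ.* (+ p ℤ.- ∣A∣)                       ∎

    module _ (A+B⊆primitive : A +ˢ B ⊆ᵁ IsPrimitive) where

      T-on-B : ∀ {b} → b ∈ B → T b ≡ ℤ.- ∣A∣
      T-on-B {b} b∈B = begin
        sum (λ a → w a ℤ.* χ (a + b))   ≡⟨ sum-cong-≗ term ⟩
        sum (λ a → w a ℤ.* -1ℤ)         ≡⟨ *-distribʳ-sum -1ℤ w ⟨
        sum w ℤ.* -1ℤ                   ≡⟨ cong (ℤ._* -1ℤ) (sum-indicator A) ⟩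
        ∣A∣ ℤ.* -1ℤ                     ≡⟨ trans (ℤ.*-comm ∣A∣ -1ℤ) (ℤ.-1*i≡-i ∣A∣) ⟩
        ℤ.- ∣A∣                         ∎
        where
        term : ∀ a → w a ℤ.* χ (a + b) ≡ w a ℤ.* -1ℤ
        term a with indicator-cases A a
        ... | inj₁ (a∈A , _) = cong (w a ℤ.*_) (χ-primitive (A+B⊆primitive (a , b , a∈A , b∈B , refl)))
        ... | inj₂ wa≡0 = trans (cong (ℤ._* χ (a + b)) wa≡0) (sym (cong (ℤ._* -1ℤ) wa≡0))

      -- On B the square equals |A|²; off B the left side contributes nothing and a square is
      -- nonnegative.
      ∣B∣∣A∣²≤sum-T² : + ∣ B ∣ ℤ.* (∣A∣ ℤ.* ∣A∣) ℤ.≤ sum (λ x → T x ℤ.* T x)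
      ∣B∣∣A∣²≤sum-T² = subst (ℤ._≤ sum (λ x → T x ℤ.* T x))
        (trans (sym (*-distribʳ-sum (∣A∣ ℤ.* ∣A∣) (indicator B)))
          (cong (ℤ._* (∣A∣ ℤ.* ∣A∣)) (sum-indicator B)))
        (sum-mono-≤ term)
        where
        neg-square : ∀ i → 1ℤ ℤ.* (i ℤ.* i) ≡ ℤ.- i ℤ.* ℤ.- i
        neg-square = ℤ-Solver.solve-∀

        term : ∀ x → indicator B x ℤ.* (∣A∣ ℤ.* ∣A∣) ℤ.≤ T x ℤ.* T x
        term x with indicator-cases B x
        ... | inj₁ (x∈B , wx≡1) = ℤ.≤-reflexive (trans (cong (ℤ._* (∣A∣ ℤ.* ∣A∣)) wx≡1)
                (trans (neg-square ∣A∣) (sym (cong₂ ℤ._*_ (T-on-B x∈B) (T-on-B x∈B)))))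
        ... | inj₂ wx≡0 = ℤ.≤-trans (ℤ.≤-reflexive (cong (ℤ._* (∣A∣ ℤ.* ∣A∣)) wx≡0)) (0≤i*i (T x))

      -- The subtracted |A|² is moved across so that the bound can be stated over ℕ.
      ∣B∣∣A∣²+∣A∣²≤p∣A∣ : ∣ B ∣ ℕ.* (∣ A ∣ ℕ.* ∣ A ∣) ℕ.+ ∣ A ∣ ℕ.* ∣ A ∣ ℕ.≤ p ℕ.* ∣ A ∣
      ∣B∣∣A∣²+∣A∣²≤p∣A∣ = ℤ.drop‿+≤+ (subst₂ ℤ._≤_ lhs rhs (ℤ.+-monoˡ-≤ (∣A∣ ℤ.* ∣A∣) ∣B∣∣A∣²≤sum-T²))
        where
        lhs : + ∣ B ∣ ℤ.* (∣A∣ ℤ.* ∣A∣) ℤ.+ ∣A∣ ℤ.* ∣A∣ ≡ + (∣ B ∣ ℕ.* (∣ A ∣ ℕ.* ∣ A ∣) ℕ.+ ∣ A ∣ ℕ.* ∣ A ∣)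
        lhs = sym (cong₂ ℤ._+_
          (trans (ℤ.pos-* ∣ B ∣ (∣ A ∣ ℕ.* ∣ A ∣)) (cong (+ ∣ B ∣ ℤ.*_) (ℤ.pos-* ∣ A ∣ ∣ A ∣)))
          (ℤ.pos-* ∣ A ∣ ∣ A ∣))

        add-back : ∀ i j → i ℤ.- j ℤ.+ j ≡ i
        add-back = ℤ-Solver.solve-∀

        rhs : sum (λ x → T x ℤ.* T x) ℤ.+ ∣A∣ ℤ.* ∣A∣ ≡ + (p ℕ.* ∣ A ∣)
        rhs = trans (cong (ℤ._+ ∣A∣ ℤ.* ∣A∣) sum-T²)
          (trans (add-back (+ p ℤ.* ∣A∣) (∣A∣ ℤ.* ∣A∣)) (sym (ℤ.pos-* p ∣ A ∣)))

-- From natural numbers to Dedekind cuts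

-- `_/_` normalises by a gcd, which is stuck on a variable; the explicit fraction lets comparisons
-- and products compute.
n/1≡n : ∀ m → + m / 1 ≡ mkℚ (+ m) 0 (Coprimality.sym (1-coprimeTo m))
n/1≡n m = ℚ.↥p/↧p≡p (mkℚ (+ m) 0 (Coprimality.sym (1-coprimeTo m)))

/1-homo-* : ∀ a b → (+ a / 1) ℚ.* (+ b / 1) ≡ + (a ℕ.* b) / 1
/1-homo-* a b = trans (cong₂ ℚ._*_ (n/1≡n a) (n/1≡n b)) (cong (_/ 1) (sym (ℤ.pos-* a b)))

/1-mono-≤ : ∀ {a b} → a ℕ.≤ b → + a / 1 ℚ.≤ + b / 1
/1-mono-≤ {a} {b} a≤b = subst₂ ℚ._≤_ (sym (n/1≡n a)) (sym (n/1≡n b))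
  (*≤* (ℤ.*-monoʳ-≤-nonNeg (+ 1) (+≤+ a≤b)))

/1-mono-< : ∀ {a b} → a ℕ.< b → + a / 1 ℚ.< + b / 1
/1-mono-< {a} {b} a<b = subst₂ ℚ._<_ (sym (n/1≡n a)) (sym (n/1≡n b))
  (*<* (ℤ.*-monoʳ-<-pos (+ 1) (+<+ a<b)))

-- A negative q lies below k at once. Otherwise q² < m ≤ k², and k ≤ q would give k² ≤ q².
√-≤ : ∀ m k → m ℕ.≤ k ℕ.* k → √ (fromℕ m) ≤ᴿ fromℕ k
√-≤ m k m≤k² q (inj₁ q<0)  = ℚ.<-≤-trans q<0 (/1-mono-≤ {0} {k} z≤n)
√-≤ m k m≤k² q (inj₂ q²<m) = ℚ.≰⇒> λ k≤q → ℚ.<-irrefl refl (ℚ.<-≤-trans q²<m (ℚ.≤-trans (/1-mono-≤ m≤k²)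
  (subst (ℚ._≤ q ℚ.* q) (/1-homo-* k k) (ℚ.≤-trans
    (ℚ.*-monoˡ-≤-nonNeg (+ k / 1) {{ℚ.nonNegative 0≤k}} k≤q)
    (ℚ.*-monoʳ-≤-nonNeg q {{ℚ.nonNegative (ℚ.≤-trans 0≤k k≤q)}} k≤q)))))
  where
  0≤k : 0ℚ ℚ.≤ + k / 1
  0≤k = /1-mono-≤ {0} {k} z≤n

-- As k² < m, k itself lies in the lower cut of the root, and roundedness gives the separating
-- rational above it.
<-√ : ∀ k m → k ℕ.* k ℕ.< m → fromℕ k <ᴿ √ (fromℕ m)
<-√ k m k²<m = ℝ.L-rounded (√ (fromℕ m)) (inj₂ (subst (ℚ._< + m / 1) (sym (/1-homo-* k k)) (/1-mono-< k²<m)))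

∣A∣²<p : ∀ {n} → Prime (suc n) → 2 ∤ suc n → (A B : Subset (suc n)) →
         A +ˢ B ⊆ᵁ IsPrimitive → ∣ A ∣ ≡ ∣ B ∣ → ∣ A ∣ ℕ.* ∣ A ∣ ℕ.< suc n
∣A∣²<p {n} p-prime 2∤p A B A+B⊆P ∣A∣≡∣B∣ with 2∣n⊎2∣1+n n
... | inj₂ 2∣p             = contradiction 2∣p 2∤p
... | inj₁ (divides-refl h) = k³+k²≤pk⇒k²<p a
  (subst (λ b → b ℕ.* (a ℕ.* a) ℕ.+ a ℕ.* a ℕ.≤ suc n ℕ.* a) (sym ∣A∣≡∣B∣)
    (QuadraticCharacter.∣B∣∣A∣²+∣A∣²≤p∣A∣ h p-prime A B A+B⊆P))
  where
  a : ℕ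
  a = ∣ A ∣

  -- Cancelling one k leaves k² + k ≤ p, and k > 0 makes k² < p strict. For k = 0 nothing can be
  -- cancelled, but p is positive.
  k³+k²≤pk⇒k²<p : ∀ k → k ℕ.* (k ℕ.* k) ℕ.+ k ℕ.* k ℕ.≤ suc n ℕ.* k → k ℕ.* k ℕ.< suc n
  k³+k²≤pk⇒k²<p zero      _ = z<s
  k³+k²≤pk⇒k²<p k@(suc _) le = ℕ.<-≤-trans (ℕ.m<m+n (k ℕ.* k) z<s)
    (ℕ.*-cancelʳ-≤ (k ℕ.* k ℕ.+ k) (suc n) k (subst (ℕ._≤ suc n ℕ.* k) (factor k) le))
    where
    factor : ∀ k → k ℕ.* (k ℕ.* k) ℕ.+ k ℕ.* k ≡ (k ℕ.* k ℕ.+ k) ℕ.* k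
    factor = solve-∀

theorem1p3 : (p : ℕ) .{{_ : NonZero p}} → Prime p → 2 ∤ p →
    (A B : Subset p) → (A +ˢ B) ≐ IsPrimitive → ∣ A ∣ ≡ ∣ B ∣ →
    (√ (fromℕ (φ (p ∸ 1))) ≤ᴿ fromℕ ∣ A ∣) × (fromℕ ∣ A ∣ <ᴿ √ (fromℕ p))
theorem1p3 (suc n) p-prime 2∤p A B (A+B⊆P , P⊆A+B) ∣A∣≡∣B∣ =
  √-≤ (φ n) a (subst (λ b → φ n ℕ.≤ a ℕ.* b) (sym ∣A∣≡∣B∣) (PrimitiveRoots.φ≤∣A∣*∣B∣ n p-prime A B P⊆A+B)) ,
  <-√ a (suc n) (∣A∣²<p p-prime 2∤p A B A+B⊆P ∣A∣≡∣B∣)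
  where
  a : ℕ
  a = ∣ A ∣
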